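{- Let $\beta\ge5$, $\epsilon_1\in\{0,1\}$ and $\epsilon_2\in\{1,-1\}$. There is no tight chiral $4$-polytope of type $\{2^{\beta-2},2^{\beta-1},2^\beta\}$ whose standard generators satisfy $\sigma_2\sigma_1^{ -1}=\sigma_1\sigma_2^{3-\epsilon_12^{\beta-2}}$, $\sigma_3^{ -1}\sigma_2=\sigma_2^{ -1+2^{\beta-2}}\sigma_3^{ -3+\epsilon_22^{\beta-2}}$ and $\sigma_3\sigma_2^{ -1}=\sigma_2^{1+2^{\beta-2}}\sigma_3^{3+\epsilon_22^{\beta-2}}$.
   Context: For a chiral polytope with base flag $\Phi$, the standard generators $\sigma_1,\sigma_2,\sigma_3$ of its automorphism group are the automorphisms with $\Phi\sigma_i=\Phi^{i(i-1)}$, where $\Phi^j$ is the flag differing from $\Phi$ only in its $j$-face; for type $\{p,q,r\}$ they have orders $p,q,r$ and satisfy $(\sigma_1\sigma_2)^2=(\sigma_2\sigma_3)^2=(\sigma_1\sigma_2\sigma_3)^2=1$. Tight: type $\{p,q,r\}$ with exactly $2pqr$ flags. -}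

module Defs where

open import Algebra.Bundles using (Group)
import Algebra.Definitions.RawMonoid as RawMonoidDefinitions
open import Data.Fin.Base as Fin using (Fin; toℕ; inject₁)
open import Data.Integer.Base as ℤ using (ℤ; +_; -[1+_])
open import Data.List.Base using (List)
open import Data.List.Relation.Unary.All using (All)
open import Data.List.Relation.Unary.AllPairs using (AllPairs)
open import Data.Nat.Base as ℕ using (ℕ; suc)
open import Data.Product.Base using (Σ; ∃; ∃₂; _×_; _,_; proj₁)
open import Data.Sum.Base using (_⊎_)
open import Data.Vec.Base as Vec using (Vec; lookup)
open import Function.Bundles using (Inverse; _↔_; _⇔_; mk⇔; Equivalence)
open import Function.Construct.Composition using (_↔-∘_; _⇔-∘_)
open import Function.Construct.Identity using (↔-id; ⇔-id)
open import Function.Construct.Symmetry using (↔-sym)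
open import Level using (Level; 0ℓ)
open import Relation.Binary.Bundles using (Setoid)
import Relation.Binary.Construct.On as On
open import Relation.Binary.Construct.Closure.ReflexiveTransitive using (Star)
open import Relation.Binary.Core using (Rel)
open import Relation.Binary.PropositionalEquality using (_≡_; _≢_; refl; sym; trans; cong; subst₂; setoid; _→-setoid_)
open import Relation.Binary.Structures using (IsPartialOrder)
open import Relation.Nullary.Negation.Core using (¬_)

module _ {c ℓ : Level} (G : Group c ℓ) where
  open Group G
  open RawMonoidDefinitions rawMonoid using () renaming (_×_ to _times_)

  -- The library's monoid powers are written additively: n times g is gⁿ.
  zpow : Carrier → ℤ → Carrier
  zpow g (+ n)    = n times g
  zpow g -[1+ n ] = (suc n times g) ⁻¹

  record Relations (β : ℕ) (ε₁ ε₂ : ℤ) (σ₁ σ₂ σ₃ : Carrier) : Set ℓ where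
    private
      infixr 9 _↑_
      _↑_ : Carrier → ℤ → Carrier
      _↑_ = zpow

      N : ℤ
      N = + (2 ℕ.^ (β ℕ.∸ 2))

    field
      relation₁ : σ₂ ∙ σ₁ ⁻¹ ≈ σ₁ ∙ σ₂ ↑ (+ 3 ℤ.- ε₁ ℤ.* N)
      relation₂ : σ₃ ⁻¹ ∙ σ₂ ≈ σ₂ ↑ (ℤ.- + 1 ℤ.+ N) ∙ σ₃ ↑ (ℤ.- + 3 ℤ.+ ε₂ ℤ.* N)
      relation₃ : σ₃ ∙ σ₂ ⁻¹ ≈ σ₂ ↑ (+ 1 ℤ.+ N) ∙ σ₃ ↑ (+ 3 ℤ.+ ε₂ ℤ.* N)

HasSize : ∀ {c ℓ} → Setoid c ℓ → ℕ → Set _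
HasSize S n = Inverse (setoid (Fin n)) S

-- Ranks -1, 0, …, n are shifted by one: rank F = k means that F is a
-- (k - 1)-face.
record RankedPoset (n : ℕ) : Set₁ where
  infix 4 _≤_ _<_
  field
    Face           : Set
    _≤_            : Rel Face 0ℓ
    isPartialOrder : IsPartialOrder _≡_ _≤_
    rank           : Face → Fin (2 ℕ.+ n)

  _<_ : Rel Face 0ℓ
  F < G = F ≤ G × F ≢ G

  field
    rank-mono : ∀ {F G} → F < G → rank F Fin.< rank G

  IsChain : List Face → Set
  IsChain = AllPairs (λ F G → F ≤ G ⊎ G ≤ F)

  record Flag : Set where
    field
      face      : Fin (2 ℕ.+ n) → Face
      face-rank : ∀ k → rank (face k) ≡ k
      face-mono : ∀ {k l} → k Fin.≤ l → face k ≤ face l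

  open Flag public

  flagSetoid : Setoid 0ℓ 0ℓ
  flagSetoid = On.setoid (Fin (2 ℕ.+ n) →-setoid Face) face

  open Setoid flagSetoid public using () renaming (_≈_ to _≈ᶠ_)

  infix 4 _∈ᶠ_
  _∈ᶠ_ : Face → Flag → Set
  F ∈ᶠ Φ = ∃ λ k → face Φ k ≡ F

  properRank : Fin n → Fin (2 ℕ.+ n)
  properRank j = Fin.suc (inject₁ j)

  -- Adjacent j Φ Ψ says Ψ = Φ^j: the two flags differ in the j-face and
  -- in no other. By the diamond condition Φ determines such a Ψ.
  Adjacent : Fin n → Rel Flag 0ℓ
  Adjacent j Φ Ψ =
    face Φ (properRank j) ≢ face Ψ (properRank j) ×
    (∀ k → k ≢ properRank j → face Φ k ≡ face Ψ k)

  -- Θ ⊇ Φ ∩ Ψ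
  ContainsMeet : Flag → Flag → Flag → Set
  ContainsMeet Φ Ψ Θ = ∀ F → F ∈ᶠ Φ → F ∈ᶠ Ψ → F ∈ᶠ Θ

  StepOver : Flag → Flag → Rel Flag 0ℓ
  StepOver Φ Ψ Θ Θ′ = (∃ λ j → Adjacent j Θ Θ′) × ContainsMeet Φ Ψ Θ′

record IsPolytope {n : ℕ} (R : RankedPoset n) : Set where
  open RankedPoset R
  field
    least      : ∃ λ F → ∀ G → F ≤ G
    greatest   : ∃ λ F → ∀ G → G ≤ F

    -- The maximal chains are exactly the flags, so each of them has n + 2
    -- faces, one of each rank.
    extend     : ∀ C → IsChain C → ∃ λ (Φ : Flag) → All (_∈ᶠ Φ) C

    diamond    : ∀ F G → F < G → toℕ (rank G) ≡ 2 ℕ.+ toℕ (rank F) →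
                 ∃₂ λ H K → H ≢ K × (F < H × H < G) × (F < K × K < G) ×
                   (∀ L → F < L → L < G → L ≡ H ⊎ L ≡ K)

    -- Strong flag-connectedness.
    connected  : ∀ Φ Ψ → ∃ λ Ψ′ → Star (StepOver Φ Ψ) Φ Ψ′ × Ψ′ ≈ᶠ Ψ

record Polytope (n : ℕ) : Set₁ where
  field
    rankedPoset : RankedPoset n
    isPolytope  : IsPolytope rankedPoset
  open RankedPoset rankedPoset public
  open IsPolytope isPolytope public

module _ {n : ℕ} (P : Polytope n) where
  open Polytope P

  record Automorphism : Set where
    field
      bijection : Face ↔ Face
    open Inverse bijection public using (to; from; strictlyInverseˡ; strictlyInverseʳ)
    field
      order     : ∀ F G → F ≤ G ⇔ to F ≤ to G

  open Automorphism

  -- Automorphisms act on the right: φ ∙ ψ is φ followed by ψ.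
  automorphismGroup : Group 0ℓ 0ℓ
  automorphismGroup = record
    { Carrier = Automorphism
    ; _≈_     = λ φ ψ → ∀ F → to φ F ≡ to ψ F
    ; _∙_     = λ φ ψ → record
        { bijection = bijection ψ ↔-∘ bijection φ
        ; order     = λ F G → order ψ (to φ F) (to φ G) ⇔-∘ order φ F G
        }
    ; ε       = record { bijection = ↔-id Face ; order = λ F G → ⇔-id (F ≤ G) }
    ; _⁻¹     = inv
    ; isGroup = record
        { isMonoid = record
            { isSemigroup = record
                { isMagma = record
                    { isEquivalence = record
                        { refl  = λ F → refl
                        ; sym   = λ p F → sym (p F)
                        ; trans = λ p q F → trans (p F) (q F)
                        }
                    ; ∙-cong = λ {_} {φ′} {ψ} p q F →
                        trans (cong (to ψ) (p F)) (q (to φ′ F))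
                    }
                ; assoc = λ _ _ _ F → refl
                }
            ; identity = (λ _ F → refl) , (λ _ F → refl)
            }
        ; inverse = strictlyInverseˡ , strictlyInverseʳ
        ; ⁻¹-cong = λ {φ} {ψ} p F →
            trans (cong (from φ) (sym (trans (p (from ψ F)) (strictlyInverseˡ ψ F))))
                  (strictlyInverseʳ φ (from ψ F))
        }
    }
    where
    inv : Automorphism → Automorphism
    inv φ = record
      { bijection = ↔-sym (bijection φ)
      ; order     = λ F G → mk⇔
          (λ le → Equivalence.from (order φ (from φ F) (from φ G))
                    (subst₂ _≤_ (sym (strictlyInverseˡ φ F)) (sym (strictlyInverseˡ φ G)) le))
          (λ le → subst₂ _≤_ (strictlyInverseˡ φ F) (strictlyInverseˡ φ G)
                    (Equivalence.to (order φ (from φ F) (from φ G)) le))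
      }

  -- Φφ = Ψ
  Maps : Automorphism → Rel Flag 0ℓ
  Maps φ Φ Ψ = ∀ k → to φ (face Φ k) ≡ face Ψ k

  SameOrbit : Rel Flag 0ℓ
  SameOrbit Φ Ψ = ∃ λ φ → Maps φ Φ Ψ

  record IsChiral : Set where
    field
      twoOrbits      : ∃₂ λ Φ Ψ → ¬ SameOrbit Φ Ψ ×
                         (∀ Θ → SameOrbit Φ Θ ⊎ SameOrbit Ψ Θ)
      adjacentOrbits : ∀ j Φ Ψ → Adjacent j Φ Ψ → ¬ SameOrbit Φ Ψ

module _ {m : ℕ} (P : Polytope (suc m)) where
  open Polytope P

  sectionVertices : Face → Face → Setoid 0ℓ 0ℓ
  sectionVertices F G =
    On.setoid {B = Σ Face λ H → F ≤ H × H ≤ G × toℕ (rank H) ≡ suc (toℕ (rank F))}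
      (setoid Face) proj₁

  -- Type {p₁, …, pₘ}, with pᵢ₊₁ = lookup ps i for i : Fin m: every section G/F
  -- of an (i - 1)-face F and an incident (i + 2)-face G is a pᵢ₊₁-gon. Such a
  -- section is a 2-polytope, and a p-gon is a 2-polytope with p vertices.
  HasType : Vec ℕ m → Set
  HasType ps = ∀ (i : Fin m) F G → F ≤ G →
    toℕ (rank F) ≡ toℕ i → toℕ (rank G) ≡ 3 ℕ.+ toℕ i →
    HasSize (sectionVertices F G) (lookup ps i)

  IsTightOfType : Vec ℕ m → Set
  IsTightOfType ps =
    HasType ps × HasSize flagSetoid (2 ℕ.* Vec.foldr′ ℕ._*_ 1 ps)

  -- For i : Fin m this says that σ is σᵢ₊₁ for the base flag Φ, that is
  -- Φσ = (Φ^(i+1))^i.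
  IsStandardGenerator : Flag → Fin m → Automorphism P → Set
  IsStandardGenerator Φ i σ = ∃₂ λ Θ Ψ →
    Adjacent (Fin.suc i) Φ Θ × Adjacent (inject₁ i) Θ Ψ × Maps P σ Φ Ψ

{-# OPTIONS --safe #-}
module Submission where

-- Write a, b, c for σ₁, σ₂, σ₃ and N = 2^(β-2), x = b², w = b^N, h = c^N,
-- v = c^(2N). The relations say that xcx = wc^K with K = -3 + ε₂N, and that w
-- conjugates c to cv. As a conjugates c to xc, conjugating xcx = wc^K by a gives
-- (xc)^K = xc^KV with V ∈ {1, v}. Since (xc)⁴ is a power of c, it follows that x
-- inverts an odd power of h. But ab inverts c and a inverts h, so b commutes
-- with h, and so does x. Hence v = h² = 1, whereas σ₃ has order 2^β = 4N.
--
-- For that order: by strong connectedness the vertices of the 2-section of Φ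
-- belonging to σᵢ form one orbit of σᵢ, and by chirality a power of σᵢ fixing
-- the vertex in Φ fixes the flag Φ, hence is trivial.

open import Algebra.Bundles using (Group)
import Algebra.Properties.Group as GroupProperties
open import Data.Empty using (⊥-elim)
open import Data.Fin.Base as Fin using (Fin; zero; suc; toℕ; inject₁)
open import Data.Fin.Induction using (<-weakInduction)
import Data.Fin.Properties as Fin
open import Data.Fin.Patterns using (0F; 1F; 2F; 3F)
open import Data.Integer.Base as ℤ using (ℤ; +_; -[1+_]; 0ℤ; 1ℤ; -1ℤ)
open import Data.Integer.DivMod using (_/ℕ_; _%ℕ_; n%ℕd<d; a≡a%ℕn+[a/ℕn]*n)
import Data.Integer.Properties as ℤ
open import Data.Integer.Tactic.RingSolver using (solve-∀)
open import Data.List.Base using ([]; _∷_; map; filter; allFin)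
open import Data.List.Membership.Propositional.Properties using (∈-filter⁺; ∈-allFin)
open import Data.List.Relation.Unary.All as All using (All; []; _∷_)
import Data.List.Relation.Unary.All.Properties as All
open import Data.List.Relation.Unary.AllPairs using (AllPairs; []; _∷_)
import Data.List.Relation.Unary.AllPairs.Properties as AllPairs
open import Data.Nat.Base as ℕ using (ℕ; zero; suc; z≤n; s≤s)
import Data.Nat.Properties as ℕ
open import Data.Product.Base using (∃; ∃₂; Σ-syntax; _×_; _,_; proj₁; proj₂)
open import Data.Sum.Base using (_⊎_; inj₁; inj₂)
open import Data.Vec.Base using (Vec; lookup; []; _∷_)
open import Function.Bundles using (Inverse; Equivalence)
open import Level using (Level; _⊔_)
open import Relation.Binary.Bundles using (Setoid)
open import Relation.Binary.Construct.Closure.ReflexiveTransitive using (Star; _◅_) renaming (ε to ε*)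
open import Relation.Binary.PropositionalEquality as ≡ using (_≡_; _≢_)
import Relation.Binary.Reasoning.Setoid as SetoidReasoning
open import Relation.Binary.Structures using (IsPartialOrder)
open import Relation.Nullary.Decidable using (Dec; yes; no; ¬?; _×-dec_)
open import Relation.Nullary.Negation using (¬_; contradiction)
open import Tactic.MonoidSolver using (solve)

open import Defs

-- The second and third relations both evaluate xcx, as wc^K and as (wc^L)⁻¹ with L = 3 + ε₂N. Since
-- -L = K - 2ε₂N and c^(2ε₂N) = v, the mismatch is exactly v; this is how w acquires its action on
-- c. The catch is that v then stands outside two factors x, so it has to be known to commute with x
-- before cv can be isolated. The divisibility of N by 8, supplied by β ≥ 5, gives K = 4J + 1 with J
-- odd. Hence (xc)^K = ((xc)⁴)^J xc, the last c cancels, and x conjugates c^(4J(1+2J)) to c^(4J)V.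
-- Raising this to the even power N/4 removes V, whichever value ε₁ has, and leaves h^(-J)
-- conjugated to h^J. Oddness of J turns h^(2J) = 1 into v = 1. On the geometric side, faces carry
-- no decidable equality; where cases on faces are needed, the diamond condition decides them.

-- Integer powers and conjugation in an arbitrary group.

module GroupPowers {g ℓ : Level} (G : Group g ℓ) where
  open Group G
  open GroupProperties G
  open SetoidReasoning setoid

  infixr 8 _^_
  _^_ : Carrier → ℤ → Carrier
  _^_ = zpow G

  -- Conj h y y′ says y^h = y′ for the right conjugation y^h = h⁻¹yh.
  Conj : Carrier → Carrier → Carrier → Set ℓ
  Conj h y y′ = y ∙ h ≈ h ∙ y′

  conj-resp : ∀ {h y₁ y₂ z₁ z₂} → y₁ ≈ y₂ → z₁ ≈ z₂ → Conj h y₁ z₁ → Conj h y₂ z₂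
  conj-resp p q r = trans (∙-congʳ (sym p)) (trans r (∙-congˡ q))

  conj-unique : ∀ {h y z₁ z₂} → Conj h y z₁ → Conj h y z₂ → z₁ ≈ z₂
  conj-unique p q = ∙-cancelˡ _ _ _ (trans (sym p) q)

  conj-ε : ∀ {h} → Conj h ε ε
  conj-ε = solve monoid

  conj-∙ : ∀ {h y y′ z z′} → Conj h y y′ → Conj h z z′ → Conj h (y ∙ z) (y′ ∙ z′)
  conj-∙ {h} {y} {y′} {z} {z′} p q = begin
    y ∙ z ∙ h      ≈⟨ assoc y z h ⟩
    y ∙ (z ∙ h)    ≈⟨ ∙-congˡ q ⟩
    y ∙ (h ∙ z′)   ≈⟨ assoc y h z′ ⟨
    y ∙ h ∙ z′     ≈⟨ ∙-congʳ p ⟩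
    h ∙ y′ ∙ z′    ≈⟨ assoc h y′ z′ ⟩
    h ∙ (y′ ∙ z′)  ∎

  conj-⁻¹ : ∀ {h y y′} → Conj h y y′ → Conj h (y ⁻¹) (y′ ⁻¹)
  conj-⁻¹ {h} {y} {y′} p = ∙-cancelˡ y _ _ (∙-cancelʳ y′ _ _ (begin
    y ∙ (y ⁻¹ ∙ h) ∙ y′   ≈⟨ solve monoid ⟩
    (y ∙ y ⁻¹) ∙ (h ∙ y′) ≈⟨ ∙-cong (inverseʳ y) (sym p) ⟩
    ε ∙ (y ∙ h)           ≈⟨ solve monoid ⟩
    y ∙ h ∙ ε             ≈⟨ ∙-congˡ (inverseˡ y′) ⟨
    y ∙ h ∙ (y′ ⁻¹ ∙ y′)  ≈⟨ solve monoid ⟩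
    y ∙ (h ∙ y′ ⁻¹) ∙ y′  ∎))

  conj-^ : ∀ {h y y′} i → Conj h y y′ → Conj h (y ^ i) (y′ ^ i)
  conj-^ {h} {y} {y′} i p = go i
    where
    go⁺ : ∀ n → Conj h (y ^ + n) (y′ ^ + n)
    go⁺ zero    = conj-ε
    go⁺ (suc n) = conj-∙ p (go⁺ n)

    go : ∀ i → Conj h (y ^ i) (y′ ^ i)
    go (+ n)    = go⁺ n
    go -[1+ n ] = conj-⁻¹ (go⁺ (suc n))

  -- Conjugation by `ε` is equality, so `conj-^` already contains the induction.
  ^-cong : ∀ {x y} i → x ≈ y → x ^ i ≈ y ^ i
  ^-cong {x} {y} i p = begin
    x ^ i      ≈⟨ identityʳ _ ⟨
    x ^ i ∙ ε  ≈⟨ conj-^ i (trans (identityʳ x) (trans p (sym (identityˡ y)))) ⟩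
    ε ∙ y ^ i  ≈⟨ identityˡ _ ⟩
    y ^ i      ∎

  ^-exp : ∀ x {i j} → i ≡ j → x ^ i ≈ x ^ j
  ^-exp x p = reflexive (≡.cong (x ^_) p)

  ^-1 : ∀ x → x ^ 1ℤ ≈ x
  ^-1 x = identityʳ x

  ^-suc : ∀ x i → x ^ ℤ.suc i ≈ x ∙ x ^ i
  ^-suc x (+ n)           = refl
  ^-suc x -[1+ zero ]     = sym (trans (∙-congˡ (⁻¹-cong (identityʳ x))) (inverseʳ x))
  ^-suc x -[1+ suc n ]    = begin
    s ⁻¹                ≈⟨ identityˡ _ ⟨
    ε ∙ s ⁻¹            ≈⟨ ∙-congʳ (inverseʳ x) ⟨
    x ∙ x ⁻¹ ∙ s ⁻¹     ≈⟨ assoc _ _ _ ⟩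
    x ∙ (x ⁻¹ ∙ s ⁻¹)   ≈⟨ ∙-congˡ (⁻¹-anti-homo-∙ s x) ⟨
    -- `conj-^` at `refl` says that a power of `x` commutes with `x`.
    x ∙ (s ∙ x) ⁻¹      ≈⟨ ∙-congˡ (⁻¹-cong (conj-^ (+ suc n) refl)) ⟩
    x ∙ (x ∙ s) ⁻¹      ∎
    where s = x ^ (+ suc n)

  ^-pred : ∀ x i → x ^ ℤ.pred i ≈ x ⁻¹ ∙ x ^ i
  ^-pred x i = begin
    x ^ ℤ.pred i                ≈⟨ identityˡ _ ⟨
    ε ∙ x ^ ℤ.pred i            ≈⟨ ∙-congʳ (inverseˡ x) ⟨
    x ⁻¹ ∙ x ∙ x ^ ℤ.pred i     ≈⟨ assoc _ _ _ ⟩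
    x ⁻¹ ∙ (x ∙ x ^ ℤ.pred i)   ≈⟨ ∙-congˡ (^-suc x (ℤ.pred i)) ⟨
    x ⁻¹ ∙ x ^ ℤ.suc (ℤ.pred i) ≈⟨ ∙-congˡ (^-exp x (ℤ.suc-pred i)) ⟩
    x ⁻¹ ∙ x ^ i                ∎

  ^-+ : ∀ x i j → x ^ (i ℤ.+ j) ≈ x ^ i ∙ x ^ j
  ^-+ x (+ zero) j = trans (^-exp x (ℤ.+-identityˡ j)) (sym (identityˡ _))
  ^-+ x (+ suc n) j = begin
    x ^ (+ suc n ℤ.+ j)       ≈⟨ ^-exp x (ℤ.+-assoc 1ℤ (+ n) j) ⟩
    x ^ ℤ.suc (+ n ℤ.+ j)     ≈⟨ ^-suc x (+ n ℤ.+ j) ⟩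
    x ∙ x ^ (+ n ℤ.+ j)       ≈⟨ ∙-congˡ (^-+ x (+ n) j) ⟩
    x ∙ (x ^ (+ n) ∙ x ^ j)   ≈⟨ assoc _ _ _ ⟨
    x ^ (+ suc n) ∙ x ^ j     ∎
  ^-+ x -[1+ zero ] j = trans (^-pred x j) (∙-congʳ (⁻¹-cong (sym (^-1 x))))
  ^-+ x -[1+ suc n ] j = begin
    x ^ (-[1+ suc n ] ℤ.+ j)         ≈⟨ ^-exp x (ℤ.+-assoc -1ℤ -[1+ n ] j) ⟩
    x ^ ℤ.pred (-[1+ n ] ℤ.+ j)      ≈⟨ ^-pred x (-[1+ n ] ℤ.+ j) ⟩
    x ⁻¹ ∙ x ^ (-[1+ n ] ℤ.+ j)      ≈⟨ ∙-congˡ (^-+ x -[1+ n ] j) ⟩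
    x ⁻¹ ∙ (x ^ -[1+ n ] ∙ x ^ j)    ≈⟨ assoc _ _ _ ⟨
    x ⁻¹ ∙ x ^ -[1+ n ] ∙ x ^ j      ≈⟨ ∙-congʳ (^-pred x -[1+ n ]) ⟨
    x ^ -[1+ suc n ] ∙ x ^ j         ∎

  ^-neg : ∀ x i → x ^ (ℤ.- i) ≈ (x ^ i) ⁻¹
  ^-neg x i = inverseˡ-unique _ _
    (trans (sym (^-+ x (ℤ.- i) i)) (^-exp x (ℤ.+-inverseˡ i)))

  ^-* : ∀ x i j → x ^ (i ℤ.* j) ≈ (x ^ i) ^ j
  ^-* x i = go
    where
    go⁺ : ∀ n → x ^ (i ℤ.* + n) ≈ (x ^ i) ^ + n
    go⁺ zero    = ^-exp x (ℤ.*-zeroʳ i)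
    go⁺ (suc n) = begin
      x ^ (i ℤ.* + suc n)          ≈⟨ ^-exp x (ℤ.*-suc i (+ n)) ⟩
      x ^ (i ℤ.+ i ℤ.* + n)        ≈⟨ ^-+ x i (i ℤ.* + n) ⟩
      x ^ i ∙ x ^ (i ℤ.* + n)      ≈⟨ ∙-congˡ (go⁺ n) ⟩
      x ^ i ∙ (x ^ i) ^ + n        ∎

    go : ∀ j → x ^ (i ℤ.* j) ≈ (x ^ i) ^ j
    go (+ n)    = go⁺ n
    go -[1+ n ] = begin
      x ^ (i ℤ.* -[1+ n ])         ≈⟨ ^-exp x (ℤ.neg-distribʳ-* i (+ suc n)) ⟨
      x ^ (ℤ.- (i ℤ.* + suc n))    ≈⟨ ^-neg x (i ℤ.* + suc n) ⟩
      (x ^ (i ℤ.* + suc n)) ⁻¹     ≈⟨ ⁻¹-cong (go⁺ (suc n)) ⟩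
      (x ^ i) ^ -[1+ n ]           ∎

  ε^ : ∀ i → ε ^ i ≈ ε
  ε^ i = trans (sym (^-* ε 0ℤ i)) (^-exp ε (ℤ.*-zeroˡ i))

  ^-multiple : ∀ x i {j} k → x ^ i ≈ ε → j ≡ i ℤ.* k → x ^ j ≈ ε
  ^-multiple x i k p q = trans (^-exp x q) (trans (^-* x i k) (trans (^-cong k p) (ε^ k)))

  ^-odd : ∀ x {j} i → x ∙ x ≈ ε → j ≡ 1ℤ ℤ.+ + 2 ℤ.* i → x ^ j ≈ x
  ^-odd x i p q = trans (^-exp x q) (trans (^-+ x 1ℤ (+ 2 ℤ.* i))
    (trans (∙-cong (^-1 x) (^-multiple x (+ 2) i (trans (∙-congˡ (^-1 x)) p) ≡.refl)) (identityʳ x)))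

  conj-by-involution : ∀ {w} y → w ∙ w ≈ ε → Conj w y (w ∙ y ∙ w)
  conj-by-involution {w} y p = begin
    y ∙ w              ≈⟨ identityˡ _ ⟨
    ε ∙ (y ∙ w)        ≈⟨ ∙-congʳ p ⟨
    w ∙ w ∙ (y ∙ w)    ≈⟨ solve monoid ⟩
    w ∙ (w ∙ y ∙ w)    ∎

  involution-conj : ∀ {w y z} → w ∙ w ≈ ε → w ∙ y ∙ (w ∙ z) ≈ ε → Conj w y (z ⁻¹)
  involution-conj {w} {y} {z} p q = conj-resp refl
    (inverseˡ-unique (w ∙ y ∙ w) z (begin
      w ∙ y ∙ w ∙ z    ≈⟨ assoc _ _ _ ⟩
      w ∙ y ∙ (w ∙ z)  ≈⟨ q ⟩
      ε                ∎))
    (conj-by-involution y p)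

  square-∙ : ∀ {y z} → z ∙ y ≈ y ∙ z → y ∙ z ∙ (y ∙ z) ≈ y ∙ y ∙ (z ∙ z)
  square-∙ {y} {z} p = begin
    y ∙ z ∙ (y ∙ z)    ≈⟨ solve monoid ⟩
    y ∙ (z ∙ y) ∙ z    ≈⟨ ∙-congʳ (∙-congˡ p) ⟩
    y ∙ (y ∙ z) ∙ z    ≈⟨ solve monoid ⟩
    y ∙ y ∙ (z ∙ z)    ∎

-- Consequences of (ab)² = (bc)² = (abc)² = 1.

module _ {g ℓ : Level} (G : Group g ℓ) where
  open Group G
  open GroupProperties G
  open SetoidReasoning setoid
  open GroupPowers G

  module RotationRelations
    (a b c : Carrier)
    (ab² : a ∙ b ∙ (a ∙ b) ≈ ε)
    (bc² : b ∙ c ∙ (b ∙ c) ≈ ε)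
    (abc² : a ∙ b ∙ c ∙ (a ∙ b ∙ c) ≈ ε)
    where

    x : Carrier
    x = b ∙ b

    x≈b^2 : x ≈ b ^ + 2
    x≈b^2 = ∙-congˡ (sym (^-1 b))

    cabc : c ∙ (a ∙ b) ∙ c ≈ a ∙ b
    cabc = begin
      c ∙ (a ∙ b) ∙ c                              ≈⟨ identityˡ _ ⟨
      ε ∙ (c ∙ (a ∙ b) ∙ c)                        ≈⟨ ∙-congʳ ab² ⟨
      a ∙ b ∙ (a ∙ b) ∙ (c ∙ (a ∙ b) ∙ c)          ≈⟨ solve monoid ⟩
      a ∙ b ∙ (a ∙ b ∙ c ∙ (a ∙ b ∙ c))            ≈⟨ ∙-congˡ abc² ⟩
      a ∙ b ∙ ε                                    ≈⟨ identityʳ _ ⟩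
      a ∙ b                                        ∎

    ab-inverts-c : Conj (a ∙ b) c (c ⁻¹)
    ab-inverts-c = begin
      c ∙ (a ∙ b)               ≈⟨ identityʳ _ ⟨
      c ∙ (a ∙ b) ∙ ε           ≈⟨ ∙-congˡ (inverseʳ c) ⟨
      c ∙ (a ∙ b) ∙ (c ∙ c ⁻¹)  ≈⟨ assoc _ _ _ ⟨
      c ∙ (a ∙ b) ∙ c ∙ c ⁻¹    ≈⟨ ∙-congʳ cabc ⟩
      a ∙ b ∙ c ⁻¹              ∎

    a-conj-c : Conj a c (x ∙ c)
    a-conj-c = begin
      c ∙ a                              ≈⟨ identityʳ _ ⟨
      c ∙ a ∙ ε                          ≈⟨ ∙-congˡ bc² ⟨
      c ∙ a ∙ (b ∙ c ∙ (b ∙ c))          ≈⟨ solve monoid ⟩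
      (c ∙ (a ∙ b) ∙ c) ∙ (b ∙ c)        ≈⟨ ∙-congʳ cabc ⟩
      (a ∙ b) ∙ (b ∙ c)                  ≈⟨ solve monoid ⟩
      a ∙ (b ∙ b ∙ c)                    ∎

    bab : b ∙ a ∙ b ≈ a ⁻¹
    bab = inverseʳ-unique a (b ∙ a ∙ b) (begin
      a ∙ (b ∙ a ∙ b)  ≈⟨ solve monoid ⟩
      a ∙ b ∙ (a ∙ b)  ≈⟨ ab² ⟩
      ε                ∎)

    bcb : b ∙ c ∙ b ≈ c ⁻¹
    bcb = inverseˡ-unique (b ∙ c ∙ b) c (begin
      b ∙ c ∙ b ∙ c  ≈⟨ solve monoid ⟩
      b ∙ c ∙ (b ∙ c)  ≈⟨ bc² ⟩
      ε                ∎)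

    cbc : c ∙ b ∙ c ≈ b ⁻¹
    cbc = inverseʳ-unique b (c ∙ b ∙ c) (begin
      b ∙ (c ∙ b ∙ c)  ≈⟨ solve monoid ⟩
      b ∙ c ∙ (b ∙ c)  ≈⟨ bc² ⟩
      ε                ∎)

    -- After right multiplication by `b`, `bab` turns `x ∙ a ∙ b` into `b ∙ a ⁻¹`, the left side of
    -- the first relation.
    a-conj-x : ∀ m → b ∙ a ⁻¹ ≈ a ∙ b ^ (1ℤ ℤ.+ m) → Conj a x (b ^ m)
    a-conj-x m p = ∙-cancelʳ b _ _ (begin
      b ∙ b ∙ a ∙ b         ≈⟨ solve monoid ⟩
      b ∙ (b ∙ a ∙ b)       ≈⟨ ∙-congˡ bab ⟩
      b ∙ a ⁻¹              ≈⟨ p ⟩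
      a ∙ b ^ (1ℤ ℤ.+ m)    ≈⟨ ∙-congˡ (^-exp b (ℤ.+-comm 1ℤ m)) ⟩
      a ∙ b ^ (m ℤ.+ 1ℤ)    ≈⟨ ∙-congˡ (^-+ b m 1ℤ) ⟩
      a ∙ (b ^ m ∙ b ^ 1ℤ)  ≈⟨ ∙-congˡ (∙-congˡ (^-1 b)) ⟩
      a ∙ (b ^ m ∙ b)       ≈⟨ assoc _ _ _ ⟨
      a ∙ b ^ m ∙ b         ∎)

    -- `bcb` rewrites `x ∙ c ∙ x` as `b ∙ (c ⁻¹ ∙ b)`, which the second relation evaluates.
    xcx : ∀ n y → c ⁻¹ ∙ b ≈ b ^ (-1ℤ ℤ.+ n) ∙ y → x ∙ c ∙ x ≈ b ^ n ∙ y
    xcx n y p = begin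
      b ∙ b ∙ c ∙ (b ∙ b)                ≈⟨ solve monoid ⟩
      b ∙ ((b ∙ c ∙ b) ∙ b)              ≈⟨ ∙-congˡ (∙-congʳ bcb) ⟩
      b ∙ (c ⁻¹ ∙ b)                     ≈⟨ ∙-congˡ p ⟩
      b ∙ (b ^ (-1ℤ ℤ.+ n) ∙ y)          ≈⟨ assoc _ _ _ ⟨
      b ∙ b ^ (-1ℤ ℤ.+ n) ∙ y            ≈⟨ ∙-congʳ (^-suc b (-1ℤ ℤ.+ n)) ⟨
      b ^ (1ℤ ℤ.+ (-1ℤ ℤ.+ n)) ∙ y       ≈⟨ ∙-congʳ (^-exp b (ℤ.suc-pred n)) ⟩
      b ^ n ∙ y                          ∎

    -- The third relation enters through `cbc` and gives a second evaluation of `x ∙ c ∙ x`, to be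
    -- compared with `xcx`.
    xcx-inverse : ∀ n y → c ∙ b ⁻¹ ≈ b ^ (1ℤ ℤ.+ n) ∙ y → x ∙ c ∙ x ∙ (b ^ n ∙ y) ≈ ε
    xcx-inverse n y p = begin
      b ∙ b ∙ c ∙ (b ∙ b) ∙ (b ^ n ∙ y)  ≈⟨ lemma (b ^ n) ⟩
      x ∙ c ∙ b ∙ (b ∙ b ^ n ∙ y)        ≈⟨ ∙-congˡ (∙-congʳ (^-suc b n)) ⟨
      x ∙ c ∙ b ∙ (b ^ (1ℤ ℤ.+ n) ∙ y)   ≈⟨ ∙-congˡ p ⟨
      x ∙ c ∙ b ∙ (c ∙ b ⁻¹)             ≈⟨ solve monoid ⟩
      x ∙ (c ∙ b ∙ c) ∙ b ⁻¹             ≈⟨ ∙-congʳ (∙-congˡ cbc) ⟩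
      x ∙ b ⁻¹ ∙ b ⁻¹                    ≈⟨ assoc _ _ _ ⟩
      x ∙ (b ⁻¹ ∙ b ⁻¹)                  ≈⟨ ∙-congˡ (⁻¹-anti-homo-∙ b b) ⟨
      x ∙ x ⁻¹                           ≈⟨ inverseʳ x ⟩
      ε                                  ∎
      where
      lemma : ∀ w → b ∙ b ∙ c ∙ (b ∙ b) ∙ (w ∙ y) ≈ b ∙ b ∙ c ∙ b ∙ (b ∙ w ∙ y)
      lemma w = solve monoid

  -- The collapse c^(2N) = 1.

  -- Here N = 8M and e = ε₂M.
  module Collapse
    (a b c : Carrier)
    (ab² : a ∙ b ∙ (a ∙ b) ≈ ε)
    (bc² : b ∙ c ∙ (b ∙ c) ≈ ε)
    (abc² : a ∙ b ∙ c ∙ (a ∙ b ∙ c) ≈ ε)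
    (M e ε₁ : ℤ)
    (b^16M : b ^ (+ 16 ℤ.* M) ≈ ε)
    (c^32M : c ^ (+ 32 ℤ.* M) ≈ ε)
    (c^16e : c ^ (+ 16 ℤ.* e) ≈ c ^ (+ 16 ℤ.* M))
    (ε₁-values : ε₁ ≡ 0ℤ ⊎ ε₁ ≡ 1ℤ)
    (relation₁ : b ∙ a ⁻¹ ≈ a ∙ b ^ (+ 3 ℤ.- ε₁ ℤ.* (+ 8 ℤ.* M)))
    (relation₂ : c ⁻¹ ∙ b ≈ b ^ (ℤ.- + 1 ℤ.+ + 8 ℤ.* M) ∙ c ^ (ℤ.- + 3 ℤ.+ + 8 ℤ.* e))
    (relation₃ : c ∙ b ⁻¹ ≈ b ^ (+ 1 ℤ.+ + 8 ℤ.* M) ∙ c ^ (+ 3 ℤ.+ + 8 ℤ.* e))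
    where
    open RotationRelations a b c ab² bc² abc²

    w v h : Carrier
    w = b ^ (+ 8 ℤ.* M)
    v = c ^ (+ 16 ℤ.* M)
    h = c ^ (+ 8 ℤ.* M)

    -- `K` and `L` are the exponents of `c` in the second and third relations; `J` is the odd number
    -- (K - 1)/4.
    J K L : ℤ
    J = -1ℤ ℤ.+ + 2 ℤ.* e
    K = ℤ.- + 3 ℤ.+ + 8 ℤ.* e
    L = + 3 ℤ.+ + 8 ℤ.* e

    w² : w ∙ w ≈ ε
    w² = trans (sym (^-+ b (+ 8 ℤ.* M) (+ 8 ℤ.* M))) (trans (^-exp b (eq M)) b^16M)
      where
      eq : ∀ M → + 8 ℤ.* M ℤ.+ + 8 ℤ.* M ≡ + 16 ℤ.* M
      eq = solve-∀

    v² : v ∙ v ≈ ε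
    v² = trans (sym (^-+ c (+ 16 ℤ.* M) (+ 16 ℤ.* M))) (trans (^-exp c (eq M)) c^32M)
      where
      eq : ∀ M → + 16 ℤ.* M ℤ.+ + 16 ℤ.* M ≡ + 32 ℤ.* M
      eq = solve-∀

    -- Because `v` squares to `ε`, only the parity of the cofactor of 16M matters; `q` witnesses
    -- that it is odd.
    c^-odd-v : ∀ {p} q → p ≡ + 16 ℤ.* M ℤ.* (1ℤ ℤ.+ + 2 ℤ.* q) → c ^ p ≈ v
    c^-odd-v q eq = trans (^-exp c eq)
      (trans (^-* c (+ 16 ℤ.* M) (1ℤ ℤ.+ + 2 ℤ.* q)) (^-odd v q v² ≡.refl))

    v-comm-c : v ∙ c ≈ c ∙ v
    v-comm-c = conj-^ (+ 16 ℤ.* M) refl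

    w-comm-x : Conj x w w
    w-comm-x = sym (conj-∙ b-comm-w b-comm-w)
      where
      b-comm-w : Conj w b b
      b-comm-w = sym (conj-^ (+ 8 ℤ.* M) refl)

    xcx≈wc^K : x ∙ c ∙ x ≈ w ∙ c ^ K
    xcx≈wc^K = xcx (+ 8 ℤ.* M) (c ^ K) relation₂

    -- `relation₂` gives xcx as wc^K and `relation₃` gives its inverse as wc^L, so the product of
    -- the two is `ε`.
    w-conj-c^K : Conj w (c ^ K) (c ^ (ℤ.- L))
    w-conj-c^K = conj-resp refl (sym (^-neg c L)) (involution-conj w² (begin
      w ∙ c ^ K ∙ (w ∙ c ^ L)  ≈⟨ ∙-congʳ xcx≈wc^K ⟨
      x ∙ c ∙ x ∙ (w ∙ c ^ L)  ≈⟨ xcx-inverse (+ 8 ℤ.* M) (c ^ L) relation₃ ⟩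
      ε                        ∎))

    wc^K : w ∙ c ^ K ≈ c ^ (ℤ.- L) ∙ w
    wc^K = sym (conj-resp refl (begin
      w ∙ c ^ (ℤ.- L) ∙ w  ≈⟨ ∙-congʳ w-conj-c^K ⟨
      c ^ K ∙ w ∙ w        ≈⟨ assoc _ _ _ ⟩
      c ^ K ∙ (w ∙ w)      ≈⟨ ∙-congˡ w² ⟩
      c ^ K ∙ ε            ≈⟨ identityʳ _ ⟩
      c ^ K                ∎) (conj-by-involution (c ^ (ℤ.- L)) w²))

    -- `K` and -L are odd, so the 16M-th power of `w-conj-c^K` has `v` on both sides.
    v-comm-w : Conj w v v
    v-comm-w = conj-resp
      (trans (sym (^-* c K (+ 16 ℤ.* M))) (c^-odd-v (ℤ.- + 2 ℤ.+ + 4 ℤ.* e) (eq₁ M e)))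
      (trans (sym (^-* c (ℤ.- L) (+ 16 ℤ.* M))) (c^-odd-v (ℤ.- + 2 ℤ.- + 4 ℤ.* e) (eq₂ M e)))
      (conj-^ (+ 16 ℤ.* M) w-conj-c^K)
      where
      eq₁ : ∀ M e → (ℤ.- + 3 ℤ.+ + 8 ℤ.* e) ℤ.* (+ 16 ℤ.* M)
        ≡ + 16 ℤ.* M ℤ.* (1ℤ ℤ.+ + 2 ℤ.* (ℤ.- + 2 ℤ.+ + 4 ℤ.* e))
      eq₁ = solve-∀
      eq₂ : ∀ M e → (ℤ.- (+ 3 ℤ.+ + 8 ℤ.* e)) ℤ.* (+ 16 ℤ.* M)
        ≡ + 16 ℤ.* M ℤ.* (1ℤ ℤ.+ + 2 ℤ.* (ℤ.- + 2 ℤ.- + 4 ℤ.* e))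
      eq₂ = solve-∀

    [xc]² : x ∙ c ∙ (x ∙ c) ≈ w ∙ c ^ (K ℤ.+ 1ℤ)
    [xc]² = begin
      x ∙ c ∙ (x ∙ c)        ≈⟨ assoc _ _ _ ⟨
      x ∙ c ∙ x ∙ c          ≈⟨ ∙-congʳ xcx≈wc^K ⟩
      w ∙ c ^ K ∙ c          ≈⟨ assoc _ _ _ ⟩
      w ∙ (c ^ K ∙ c)        ≈⟨ ∙-congˡ (∙-congˡ (^-1 c)) ⟨
      w ∙ (c ^ K ∙ c ^ 1ℤ)   ≈⟨ ∙-congˡ (^-+ c K 1ℤ) ⟨
      w ∙ c ^ (K ℤ.+ 1ℤ)     ∎

    [cx]² : c ∙ x ∙ (c ∙ x) ≈ c ^ (1ℤ ℤ.- L) ∙ w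
    [cx]² = begin
      c ∙ x ∙ (c ∙ x)           ≈⟨ assoc _ _ _ ⟩
      c ∙ (x ∙ (c ∙ x))         ≈⟨ ∙-congˡ (assoc _ _ _) ⟨
      c ∙ (x ∙ c ∙ x)           ≈⟨ ∙-congˡ (trans xcx≈wc^K wc^K) ⟩
      c ∙ (c ^ (ℤ.- L) ∙ w)     ≈⟨ assoc _ _ _ ⟨
      c ∙ c ^ (ℤ.- L) ∙ w       ≈⟨ ∙-congʳ (^-suc c (ℤ.- L)) ⟨
      c ^ (1ℤ ℤ.- L) ∙ w        ∎

    -- x conjugates (xc)² into (cx)², and the 8M-th powers are taken after
    -- removing the factor w.
    v-comm-x : Conj x v v
    v-comm-x = conj-resp
      (trans (sym (^-* c (K ℤ.+ 1ℤ) (+ 8 ℤ.* M))) (c^-odd-v (-1ℤ ℤ.+ + 2 ℤ.* e) (eq₁ M e)))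
      (conj-unique (conj-^ (+ 8 ℤ.* M) (conj-by-involution y w²))
        (conj-resp (sym y^8M) refl v-comm-w))
      (conj-^ (+ 8 ℤ.* M) (conj-resp
        (begin
          w ∙ (x ∙ c ∙ (x ∙ c))        ≈⟨ ∙-congˡ [xc]² ⟩
          w ∙ (w ∙ c ^ (K ℤ.+ 1ℤ))     ≈⟨ assoc _ _ _ ⟨
          w ∙ w ∙ c ^ (K ℤ.+ 1ℤ)       ≈⟨ ∙-congʳ w² ⟩
          ε ∙ c ^ (K ℤ.+ 1ℤ)           ≈⟨ identityˡ _ ⟩
          c ^ (K ℤ.+ 1ℤ)               ∎)
        (trans (∙-congˡ [cx]²) (sym (assoc _ _ _)))
        (conj-∙ w-comm-x (conj-∙ (assoc x c x) (assoc x c x)))))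
      where
      y = c ^ (1ℤ ℤ.- L)
      eq₁ : ∀ M e → (ℤ.- + 3 ℤ.+ + 8 ℤ.* e ℤ.+ 1ℤ) ℤ.* (+ 8 ℤ.* M)
        ≡ + 16 ℤ.* M ℤ.* (1ℤ ℤ.+ + 2 ℤ.* (-1ℤ ℤ.+ + 2 ℤ.* e))
      eq₁ = solve-∀
      eq₂ : ∀ M e → (1ℤ ℤ.- (+ 3 ℤ.+ + 8 ℤ.* e)) ℤ.* (+ 8 ℤ.* M)
        ≡ + 16 ℤ.* M ℤ.* (1ℤ ℤ.+ + 2 ℤ.* (-1ℤ ℤ.- + 2 ℤ.* e))
      eq₂ = solve-∀
      y^8M : y ^ (+ 8 ℤ.* M) ≈ v
      y^8M = trans (sym (^-* c (1ℤ ℤ.- L) (+ 8 ℤ.* M))) (c^-odd-v (-1ℤ ℤ.- + 2 ℤ.* e) (eq₂ M e))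

    -- Conjugate `xcx≈wc^K` by `w`, which commutes with `x`: the exponent `K` becomes -L = K - 16e,
    -- a change by the factor `v`. `v-comm-x` moves this factor next to `c`, so that both `x`
    -- cancel.
    w-conj-c : Conj w c (c ∙ v)
    w-conj-c = conj-resp refl (∙-cancelˡ x _ _ (∙-cancelʳ x _ _ (begin
      x ∙ (w ∙ c ∙ w) ∙ x    ≈⟨ conj-unique (conj-∙ (conj-∙ x-conj (conj-by-involution c w²)) x-conj)
                                  (conj-resp (sym xcx≈wc^K) refl (conj-∙ refl w-conj-c^K)) ⟩
      w ∙ c ^ (ℤ.- L)        ≈⟨ ∙-congˡ (trans (^-exp c (eq e)) (^-+ c K (ℤ.- (+ 16 ℤ.* e)))) ⟩
      w ∙ (c ^ K ∙ c ^ (ℤ.- (+ 16 ℤ.* e)))  ≈⟨ ∙-congˡ (∙-congˡ c^-16e) ⟩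
      w ∙ (c ^ K ∙ v)        ≈⟨ assoc _ _ _ ⟨
      w ∙ c ^ K ∙ v          ≈⟨ ∙-congʳ xcx≈wc^K ⟨
      x ∙ c ∙ x ∙ v          ≈⟨ assoc _ _ _ ⟩
      x ∙ c ∙ (x ∙ v)        ≈⟨ ∙-congˡ v-comm-x ⟨
      x ∙ c ∙ (v ∙ x)        ≈⟨ assoc _ _ _ ⟨
      x ∙ c ∙ v ∙ x          ≈⟨ ∙-congʳ (assoc _ _ _) ⟩
      x ∙ (c ∙ v) ∙ x        ∎))) (conj-by-involution c w²)
      where
      x-conj : Conj w x x
      x-conj = sym w-comm-x
      eq : ∀ e → ℤ.- (+ 3 ℤ.+ + 8 ℤ.* e) ≡ ℤ.- + 3 ℤ.+ + 8 ℤ.* e ℤ.- + 16 ℤ.* e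
      eq = solve-∀
      c^-16e : c ^ (ℤ.- (+ 16 ℤ.* e)) ≈ v
      c^-16e = begin
        c ^ (ℤ.- (+ 16 ℤ.* e))  ≈⟨ ^-neg c (+ 16 ℤ.* e) ⟩
        (c ^ (+ 16 ℤ.* e)) ⁻¹   ≈⟨ ⁻¹-cong c^16e ⟩
        v ⁻¹                    ≈⟨ inverseˡ-unique v v v² ⟨
        v                       ∎

    w-comm-c² : Conj w (c ^ + 2) (c ^ + 2)
    w-comm-c² = conj-resp refl (begin
      (c ∙ v) ^ + 2        ≈⟨ ∙-congˡ (^-1 (c ∙ v)) ⟩
      c ∙ v ∙ (c ∙ v)      ≈⟨ square-∙ v-comm-c ⟩
      c ∙ c ∙ (v ∙ v)      ≈⟨ ∙-cong (∙-congˡ (sym (^-1 c))) v² ⟩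
      c ^ + 2 ∙ ε          ≈⟨ identityʳ _ ⟩
      c ^ + 2              ∎) (conj-^ (+ 2) w-conj-c)

    -- The exponents are related by K = 4J + 1.
    [xc]^4 : (x ∙ c) ^ + 4 ≈ c ^ (+ 4 ℤ.* (1ℤ ℤ.+ + 2 ℤ.* J))
    [xc]^4 = begin
      (x ∙ c) ^ + 4                            ≈⟨ ^-+ (x ∙ c) (+ 2) (+ 2) ⟩
      (x ∙ c) ^ + 2 ∙ (x ∙ c) ^ + 2            ≈⟨ ∙-cong y y ⟩
      w ∙ d ∙ (w ∙ d)                          ≈⟨ square-∙ d-comm-w ⟩
      w ∙ w ∙ (d ∙ d)                          ≈⟨ ∙-cong w² (sym (^-+ c (K ℤ.+ 1ℤ) (K ℤ.+ 1ℤ))) ⟩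
      ε ∙ c ^ (K ℤ.+ 1ℤ ℤ.+ (K ℤ.+ 1ℤ))        ≈⟨ identityˡ _ ⟩
      c ^ (K ℤ.+ 1ℤ ℤ.+ (K ℤ.+ 1ℤ))            ≈⟨ ^-exp c (eq₂ e) ⟩
      c ^ (+ 4 ℤ.* (1ℤ ℤ.+ + 2 ℤ.* J))         ∎
      where
      d = c ^ (K ℤ.+ 1ℤ)
      y : (x ∙ c) ^ + 2 ≈ w ∙ d
      y = trans (∙-congˡ (^-1 (x ∙ c))) [xc]²
      eq₁ : ∀ e → + 2 ℤ.* (-1ℤ ℤ.+ + 4 ℤ.* e) ≡ ℤ.- + 3 ℤ.+ + 8 ℤ.* e ℤ.+ 1ℤ
      eq₁ = solve-∀
      eq₂ : ∀ e → ℤ.- + 3 ℤ.+ + 8 ℤ.* e ℤ.+ 1ℤ ℤ.+ (ℤ.- + 3 ℤ.+ + 8 ℤ.* e ℤ.+ 1ℤ)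
        ≡ + 4 ℤ.* (1ℤ ℤ.+ + 2 ℤ.* (-1ℤ ℤ.+ + 2 ℤ.* e))
      eq₂ = solve-∀
      d≈ : (c ^ + 2) ^ (-1ℤ ℤ.+ + 4 ℤ.* e) ≈ d
      d≈ = trans (sym (^-* c (+ 2) (-1ℤ ℤ.+ + 4 ℤ.* e))) (^-exp c (eq₁ e))
      d-comm-w : Conj w d d
      d-comm-w = conj-resp d≈ d≈ (conj-^ (-1ℤ ℤ.+ + 4 ℤ.* e) w-comm-c²)

    -- The defect in the action of `a` on `x`, which is conjugated to xz; it is `ε` or `w` according
    -- to `ε₁`.
    z : Carrier
    z = b ^ (ℤ.- (ε₁ ℤ.* (+ 8 ℤ.* M)))

    a-conj-x′ : Conj a x (x ∙ z)
    a-conj-x′ = conj-resp refl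
      (trans (^-+ b (+ 2) (ℤ.- (ε₁ ℤ.* (+ 8 ℤ.* M)))) (∙-congʳ (sym x≈b^2)))
      (a-conj-x (+ 2 ℤ.- ε₁ ℤ.* (+ 8 ℤ.* M))
        (trans relation₁ (∙-congˡ (^-exp b (ℤ.+-assoc 1ℤ (+ 2) (ℤ.- (ε₁ ℤ.* (+ 8 ℤ.* M))))))))

    -- `w` is x^(4M), and the exponent of `b` in (xz)^(4M) differs from 8M by a multiple of 16M.
    w-comm-a : Conj a w w
    w-comm-a = conj-resp
      (trans (^-cong (+ 4 ℤ.* M) x≈b^2)
        (trans (sym (^-* b (+ 2) (+ 4 ℤ.* M))) (^-exp b (eq₁ M))))
      (begin
        (x ∙ z) ^ (+ 4 ℤ.* M)
          ≈⟨ ^-cong (+ 4 ℤ.* M) (trans (^-+ b (+ 2) n) (∙-congʳ (sym x≈b^2))) ⟨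
        (b ^ (+ 2 ℤ.+ n)) ^ (+ 4 ℤ.* M)
          ≈⟨ ^-* b (+ 2 ℤ.+ n) (+ 4 ℤ.* M) ⟨
        b ^ ((+ 2 ℤ.+ n) ℤ.* (+ 4 ℤ.* M))
          ≈⟨ ^-exp b (eq₂ M ε₁) ⟩
        b ^ (+ 8 ℤ.* M ℤ.+ + 16 ℤ.* M ℤ.* (ℤ.- (+ 2 ℤ.* ε₁ ℤ.* M)))
          ≈⟨ ^-+ b (+ 8 ℤ.* M) (+ 16 ℤ.* M ℤ.* (ℤ.- (+ 2 ℤ.* ε₁ ℤ.* M))) ⟩
        w ∙ b ^ (+ 16 ℤ.* M ℤ.* (ℤ.- (+ 2 ℤ.* ε₁ ℤ.* M)))
          ≈⟨ ∙-congˡ (^-multiple b (+ 16 ℤ.* M) (ℤ.- (+ 2 ℤ.* ε₁ ℤ.* M)) b^16M ≡.refl) ⟩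
        w ∙ ε
          ≈⟨ identityʳ w ⟩
        w ∎)
      (conj-^ (+ 4 ℤ.* M) a-conj-x′)
      where
      n = ℤ.- (ε₁ ℤ.* (+ 8 ℤ.* M))
      eq₁ : ∀ M → + 2 ℤ.* (+ 4 ℤ.* M) ≡ + 8 ℤ.* M
      eq₁ = solve-∀
      eq₂ : ∀ M ε₁ → (+ 2 ℤ.- ε₁ ℤ.* (+ 8 ℤ.* M)) ℤ.* (+ 4 ℤ.* M)
        ≡ + 8 ℤ.* M ℤ.+ + 16 ℤ.* M ℤ.* (ℤ.- (+ 2 ℤ.* ε₁ ℤ.* M))
      eq₂ = solve-∀

    z-values : z ≈ ε ⊎ z ≈ w
    z-values = values ε₁-values
      where
      values : ∀ {ε₁} → ε₁ ≡ 0ℤ ⊎ ε₁ ≡ 1ℤ →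
        b ^ (ℤ.- (ε₁ ℤ.* (+ 8 ℤ.* M))) ≈ ε ⊎ b ^ (ℤ.- (ε₁ ℤ.* (+ 8 ℤ.* M))) ≈ w
      values (inj₁ ≡.refl) = inj₁ refl
      values (inj₂ ≡.refl) = inj₂ (begin
        b ^ (ℤ.- (1ℤ ℤ.* (+ 8 ℤ.* M)))  ≈⟨ ^-neg b (1ℤ ℤ.* (+ 8 ℤ.* M)) ⟩
        (b ^ (1ℤ ℤ.* (+ 8 ℤ.* M))) ⁻¹   ≈⟨ ⁻¹-cong (^-exp b (ℤ.*-identityˡ (+ 8 ℤ.* M))) ⟩
        w ⁻¹                            ≈⟨ inverseˡ-unique w w w² ⟨
        w                               ∎)

    -- Handles both values of `ε₁` at once: `V` measures the failure of `z` to commute with `c`, and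
    -- is taken as `ε` when `z` is `ε` and as `v` when `z` is `w`.
    record Twist : Set (g ⊔ ℓ) where
      field
        V        : Carrier
        V²       : V ∙ V ≈ ε
        V-comm-x : Conj x V V
        V-comm-c : Conj c V V
        zcz      : z ∙ c ∙ z ≈ c ∙ V
        z-comm-x : Conj x z z

    twist : Twist
    twist with z-values
    ... | inj₁ p = record
      { V        = ε
      ; V²       = identityˡ ε
      ; V-comm-x = conj-ε
      ; V-comm-c = conj-ε
      ; zcz      = ∙-cong (trans (∙-congʳ p) (identityˡ c)) p
      ; z-comm-x = conj-resp (sym p) (sym p) conj-ε
      }
    ... | inj₂ p = record
      { V        = v
      ; V²       = v²
      ; V-comm-x = v-comm-x
      ; V-comm-c = v-comm-c
      ; zcz      = trans (∙-cong (∙-congʳ p) p)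
                     (conj-unique (conj-by-involution c w²) w-conj-c)
      ; z-comm-x = conj-resp (sym p) (sym p) w-comm-x
      }

    open Twist twist

    -- Conjugating `xcx≈wc^K` by `a` gives (xz)(xc)(xz) = w(xc)^K. Bringing the two `z` around `c`
    -- produces `V`, and a second use of `xcx≈wc^K` produces the `w` that cancels.
    xc^KV : x ∙ c ^ K ∙ V ≈ (x ∙ c) ^ K
    xc^KV = ∙-cancelˡ w _ _ (begin
      w ∙ (x ∙ c ^ K ∙ V)          ≈⟨ assoc₄ w x (c ^ K) V ⟩
      w ∙ x ∙ c ^ K ∙ V            ≈⟨ ∙-congʳ (∙-congʳ w-comm-x) ⟩
      x ∙ w ∙ c ^ K ∙ V            ≈⟨ ∙-congʳ (assoc _ _ _) ⟩
      x ∙ (w ∙ c ^ K) ∙ V          ≈⟨ ∙-congʳ (∙-congˡ xcx≈wc^K) ⟨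
      x ∙ (x ∙ c ∙ x) ∙ V          ≈⟨ pull V ⟩
      x ∙ x ∙ c ∙ (x ∙ V)          ≈⟨ ∙-congˡ V-comm-x ⟨
      x ∙ x ∙ c ∙ (V ∙ x)          ≈⟨ pull′ V ⟩
      x ∙ x ∙ (c ∙ V) ∙ x          ≈⟨ ∙-congʳ (∙-congˡ zcz) ⟨
      x ∙ x ∙ (z ∙ c ∙ z) ∙ x      ≈⟨ pull″ z ⟩
      x ∙ (x ∙ z) ∙ c ∙ (z ∙ x)    ≈⟨ ∙-cong (∙-congʳ (∙-congˡ (sym z-comm-x))) z-comm-x ⟩
      x ∙ (z ∙ x) ∙ c ∙ (x ∙ z)    ≈⟨ pull‴ z ⟩
      x ∙ z ∙ (x ∙ c) ∙ (x ∙ z)    ≈⟨ conj-unique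
                                        (conj-∙ (conj-∙ a-conj-x′ a-conj-c) a-conj-x′)
                                        (conj-resp (sym xcx≈wc^K) refl (conj-∙ w-comm-a (conj-^ K a-conj-c))) ⟩
      w ∙ (x ∙ c) ^ K              ∎)
      where
      assoc₄ : ∀ p q r s → p ∙ (q ∙ r ∙ s) ≈ p ∙ q ∙ r ∙ s
      assoc₄ p q r s = solve monoid
      pull : ∀ V → x ∙ (x ∙ c ∙ x) ∙ V ≈ x ∙ x ∙ c ∙ (x ∙ V)
      pull V = solve monoid
      pull′ : ∀ V → x ∙ x ∙ c ∙ (V ∙ x) ≈ x ∙ x ∙ (c ∙ V) ∙ x
      pull′ V = solve monoid
      pull″ : ∀ z → x ∙ x ∙ (z ∙ c ∙ z) ∙ x ≈ x ∙ (x ∙ z) ∙ c ∙ (z ∙ x)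
      pull″ z = solve monoid
      pull‴ : ∀ z → x ∙ (z ∙ x) ∙ c ∙ (x ∙ z) ≈ x ∙ z ∙ (x ∙ c) ∙ (x ∙ z)
      pull‴ z = solve monoid

    -- Split `K` as 4J + 1 in `xc^KV`: `[xc]^4` makes (xc)^(4J) a power of `c`, and the remaining
    -- `c` cancels on the right.
    x-conj-c^4J : Conj x (c ^ (+ 4 ℤ.* (1ℤ ℤ.+ + 2 ℤ.* J) ℤ.* J)) (c ^ (+ 4 ℤ.* J) ∙ V)
    x-conj-c^4J = ∙-cancelʳ c _ _ (begin
      c ^ (+ 4 ℤ.* (1ℤ ℤ.+ + 2 ℤ.* J) ℤ.* J) ∙ x ∙ c     ≈⟨ assoc _ _ _ ⟩
      c ^ (+ 4 ℤ.* (1ℤ ℤ.+ + 2 ℤ.* J) ℤ.* J) ∙ (x ∙ c)   ≈⟨ ∙-congʳ (^-* c (+ 4 ℤ.* (1ℤ ℤ.+ + 2 ℤ.* J)) J) ⟩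
      (c ^ (+ 4 ℤ.* (1ℤ ℤ.+ + 2 ℤ.* J))) ^ J ∙ (x ∙ c)   ≈⟨ ∙-congʳ (^-cong J [xc]^4) ⟨
      ((x ∙ c) ^ + 4) ^ J ∙ (x ∙ c)                      ≈⟨ ∙-congʳ (^-* (x ∙ c) (+ 4) J) ⟨
      (x ∙ c) ^ (+ 4 ℤ.* J) ∙ (x ∙ c)                    ≈⟨ ∙-congˡ (^-1 (x ∙ c)) ⟨
      (x ∙ c) ^ (+ 4 ℤ.* J) ∙ (x ∙ c) ^ 1ℤ               ≈⟨ ^-+ (x ∙ c) (+ 4 ℤ.* J) 1ℤ ⟨
      (x ∙ c) ^ (+ 4 ℤ.* J ℤ.+ 1ℤ)                       ≈⟨ ^-exp (x ∙ c) (eq e) ⟩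
      (x ∙ c) ^ K                                        ≈⟨ xc^KV ⟨
      x ∙ c ^ K ∙ V                                      ≈⟨ assoc _ _ _ ⟩
      x ∙ (c ^ K ∙ V)                                    ≈⟨ ∙-congˡ (∙-congʳ (^-exp c (eq e))) ⟨
      x ∙ (c ^ (+ 4 ℤ.* J ℤ.+ 1ℤ) ∙ V)                   ≈⟨ ∙-congˡ (∙-congʳ (^-+ c (+ 4 ℤ.* J) 1ℤ)) ⟩
      x ∙ (c ^ (+ 4 ℤ.* J) ∙ c ^ 1ℤ ∙ V)                 ≈⟨ ∙-congˡ (∙-congʳ (∙-congˡ (^-1 c))) ⟩
      x ∙ (c ^ (+ 4 ℤ.* J) ∙ c ∙ V)                      ≈⟨ ∙-congˡ (assoc _ _ _) ⟩
      x ∙ (c ^ (+ 4 ℤ.* J) ∙ (c ∙ V))                    ≈⟨ ∙-congˡ (∙-congˡ V-comm-c) ⟨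
      x ∙ (c ^ (+ 4 ℤ.* J) ∙ (V ∙ c))                    ≈⟨ ∙-congˡ (assoc _ _ _) ⟨
      x ∙ (c ^ (+ 4 ℤ.* J) ∙ V ∙ c)                      ≈⟨ assoc _ _ _ ⟨
      x ∙ (c ^ (+ 4 ℤ.* J) ∙ V) ∙ c                      ∎)
      where
      eq : ∀ e → + 4 ℤ.* (-1ℤ ℤ.+ + 2 ℤ.* e) ℤ.+ 1ℤ ≡ ℤ.- + 3 ℤ.+ + 8 ℤ.* e
      eq = solve-∀

    h^[1+2J] : h ^ (1ℤ ℤ.+ + 2 ℤ.* J) ≈ h ^ -1ℤ
    h^[1+2J] = begin
      h ^ (1ℤ ℤ.+ + 2 ℤ.* J)         ≈⟨ ^-exp h (eq₁ e) ⟩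
      h ^ (-1ℤ ℤ.+ + 4 ℤ.* e)        ≈⟨ ^-+ h -1ℤ (+ 4 ℤ.* e) ⟩
      h ^ -1ℤ ∙ h ^ (+ 4 ℤ.* e)      ≈⟨ ∙-congˡ (^-* c (+ 8 ℤ.* M) (+ 4 ℤ.* e)) ⟨
      h ^ -1ℤ ∙ c ^ (+ 8 ℤ.* M ℤ.* (+ 4 ℤ.* e)) ≈⟨ ∙-congˡ (^-multiple c (+ 32 ℤ.* M) e c^32M (eq₂ M e)) ⟩
      h ^ -1ℤ ∙ ε                    ≈⟨ identityʳ _ ⟩
      h ^ -1ℤ                        ∎
      where
      eq₁ : ∀ e → 1ℤ ℤ.+ + 2 ℤ.* (-1ℤ ℤ.+ + 2 ℤ.* e) ≡ -1ℤ ℤ.+ + 4 ℤ.* e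
      eq₁ = solve-∀
      eq₂ : ∀ M e → + 8 ℤ.* M ℤ.* (+ 4 ℤ.* e) ≡ + 32 ℤ.* M ℤ.* e
      eq₂ = solve-∀

    -- This is the 2M-th power of `x-conj-c^4J`: the exponent is even, so `V` disappears, and the
    -- factor 4 · 2M = 8M leaves powers of `h`.
    x-inverts-h^J : Conj x (h ^ (-1ℤ ℤ.* J)) (h ^ J)
    x-inverts-h^J = conj-resp
      (begin
        (c ^ (+ 4 ℤ.* (1ℤ ℤ.+ + 2 ℤ.* J) ℤ.* J)) ^ (+ 2 ℤ.* M)
          ≈⟨ ^-* c (+ 4 ℤ.* (1ℤ ℤ.+ + 2 ℤ.* J) ℤ.* J) (+ 2 ℤ.* M) ⟨
        c ^ (+ 4 ℤ.* (1ℤ ℤ.+ + 2 ℤ.* J) ℤ.* J ℤ.* (+ 2 ℤ.* M))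
          ≈⟨ ^-exp c (eq₁ M J) ⟩
        c ^ (+ 8 ℤ.* M ℤ.* (1ℤ ℤ.+ + 2 ℤ.* J) ℤ.* J)
          ≈⟨ ^-* c (+ 8 ℤ.* M ℤ.* (1ℤ ℤ.+ + 2 ℤ.* J)) J ⟩
        (c ^ (+ 8 ℤ.* M ℤ.* (1ℤ ℤ.+ + 2 ℤ.* J))) ^ J
          ≈⟨ ^-cong J (trans (^-* c (+ 8 ℤ.* M) (1ℤ ℤ.+ + 2 ℤ.* J)) h^[1+2J]) ⟩
        (h ^ -1ℤ) ^ J
          ≈⟨ ^-* h -1ℤ J ⟨
        h ^ (-1ℤ ℤ.* J) ∎)
      (begin
        (d ∙ V) ^ (+ 2 ℤ.* M)    ≈⟨ ^-* (d ∙ V) (+ 2) M ⟩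
        ((d ∙ V) ^ + 2) ^ M      ≈⟨ ^-cong M (begin
          (d ∙ V) ^ + 2                     ≈⟨ ∙-congˡ (^-1 (d ∙ V)) ⟩
          d ∙ V ∙ (d ∙ V)                   ≈⟨ square-∙ (sym (conj-^ (+ 4 ℤ.* J) (sym V-comm-c))) ⟩
          d ∙ d ∙ (V ∙ V)                   ≈⟨ ∙-cong (sym (^-+ c (+ 4 ℤ.* J) (+ 4 ℤ.* J))) V² ⟩
          c ^ (+ 4 ℤ.* J ℤ.+ + 4 ℤ.* J) ∙ ε ≈⟨ identityʳ _ ⟩
          c ^ (+ 4 ℤ.* J ℤ.+ + 4 ℤ.* J)     ∎) ⟩
        (c ^ (+ 4 ℤ.* J ℤ.+ + 4 ℤ.* J)) ^ M ≈⟨ ^-* c (+ 4 ℤ.* J ℤ.+ + 4 ℤ.* J) M ⟨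
        c ^ ((+ 4 ℤ.* J ℤ.+ + 4 ℤ.* J) ℤ.* M) ≈⟨ ^-exp c (eq₂ M J) ⟩
        c ^ (+ 8 ℤ.* M ℤ.* J)    ≈⟨ ^-* c (+ 8 ℤ.* M) J ⟩
        h ^ J                    ∎)
      (conj-^ (+ 2 ℤ.* M) x-conj-c^4J)
      where
      d = c ^ (+ 4 ℤ.* J)
      eq₁ : ∀ M J → + 4 ℤ.* (1ℤ ℤ.+ + 2 ℤ.* J) ℤ.* J ℤ.* (+ 2 ℤ.* M)
        ≡ + 8 ℤ.* M ℤ.* (1ℤ ℤ.+ + 2 ℤ.* J) ℤ.* J
      eq₁ = solve-∀
      eq₂ : ∀ M J → (+ 4 ℤ.* J ℤ.+ + 4 ℤ.* J) ℤ.* M ≡ + 8 ℤ.* M ℤ.* J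
      eq₂ = solve-∀

    -- `a` conjugates `h` to (xc)^(8M), whose exponent is divisible by 4, so `[xc]^4` applies.
    a-inverts-h : Conj a h (h ^ -1ℤ)
    a-inverts-h = conj-resp refl (begin
      (x ∙ c) ^ (+ 8 ℤ.* M)            ≈⟨ ^-exp (x ∙ c) (eq₁ M) ⟩
      (x ∙ c) ^ (+ 4 ℤ.* (+ 2 ℤ.* M))  ≈⟨ ^-* (x ∙ c) (+ 4) (+ 2 ℤ.* M) ⟩
      ((x ∙ c) ^ + 4) ^ (+ 2 ℤ.* M)    ≈⟨ ^-cong (+ 2 ℤ.* M) [xc]^4 ⟩
      (c ^ (+ 4 ℤ.* (1ℤ ℤ.+ + 2 ℤ.* J))) ^ (+ 2 ℤ.* M) ≈⟨ ^-* c (+ 4 ℤ.* (1ℤ ℤ.+ + 2 ℤ.* J)) (+ 2 ℤ.* M) ⟨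
      c ^ (+ 4 ℤ.* (1ℤ ℤ.+ + 2 ℤ.* J) ℤ.* (+ 2 ℤ.* M)) ≈⟨ ^-exp c (eq₂ M J) ⟩
      c ^ (+ 8 ℤ.* M ℤ.* (1ℤ ℤ.+ + 2 ℤ.* J)) ≈⟨ ^-* c (+ 8 ℤ.* M) (1ℤ ℤ.+ + 2 ℤ.* J) ⟩
      h ^ (1ℤ ℤ.+ + 2 ℤ.* J)           ≈⟨ h^[1+2J] ⟩
      h ^ -1ℤ                          ∎) (conj-^ (+ 8 ℤ.* M) a-conj-c)
      where
      eq₁ : ∀ M → + 8 ℤ.* M ≡ + 4 ℤ.* (+ 2 ℤ.* M)
      eq₁ = solve-∀
      eq₂ : ∀ M J → + 4 ℤ.* (1ℤ ℤ.+ + 2 ℤ.* J) ℤ.* (+ 2 ℤ.* M) ≡ + 8 ℤ.* M ℤ.* (1ℤ ℤ.+ + 2 ℤ.* J)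
      eq₂ = solve-∀

    b-comm-h⁻¹ : Conj b (h ^ -1ℤ) (h ^ -1ℤ)
    b-comm-h⁻¹ = ∙-cancelˡ a _ _ (begin
      a ∙ (h ^ -1ℤ ∙ b)        ≈⟨ assoc _ _ _ ⟨
      a ∙ h ^ -1ℤ ∙ b          ≈⟨ ∙-congʳ a-inverts-h ⟨
      h ∙ a ∙ b                ≈⟨ assoc _ _ _ ⟩
      h ∙ (a ∙ b)              ≈⟨ conj-^ (+ 8 ℤ.* M) ab-inverts-c ⟩
      a ∙ b ∙ (c ⁻¹) ^ (+ 8 ℤ.* M)  ≈⟨ ∙-congˡ c⁻¹^ ⟩
      a ∙ b ∙ h ^ -1ℤ          ≈⟨ assoc _ _ _ ⟩
      a ∙ (b ∙ h ^ -1ℤ)        ∎)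
      where
      c⁻¹^ : (c ⁻¹) ^ (+ 8 ℤ.* M) ≈ h ^ -1ℤ
      c⁻¹^ = begin
        (c ⁻¹) ^ (+ 8 ℤ.* M)       ≈⟨ ^-cong (+ 8 ℤ.* M) (⁻¹-cong (^-1 c)) ⟨
        (c ^ -1ℤ) ^ (+ 8 ℤ.* M)    ≈⟨ ^-* c -1ℤ (+ 8 ℤ.* M) ⟨
        c ^ (-1ℤ ℤ.* (+ 8 ℤ.* M))  ≈⟨ ^-exp c (ℤ.*-comm -1ℤ (+ 8 ℤ.* M)) ⟩
        c ^ (+ 8 ℤ.* M ℤ.* -1ℤ)    ≈⟨ ^-* c (+ 8 ℤ.* M) -1ℤ ⟩
        h ^ -1ℤ                    ∎

    -- `x` conjugates h^(-J) both to h^J and to itself, so h^(2J) = `ε`; as `J` is odd, h^(2J) =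
    -- c^(16MJ) is `v`.
    v≈ε : v ≈ ε
    v≈ε = begin
      v                          ≈⟨ c^-odd-v (-1ℤ ℤ.+ e) (eq M e) ⟨
      c ^ (+ 8 ℤ.* M ℤ.* (J ℤ.+ J)) ≈⟨ ^-* c (+ 8 ℤ.* M) (J ℤ.+ J) ⟩
      h ^ (J ℤ.+ J)              ≈⟨ ^-+ h J J ⟩
      h ^ J ∙ h ^ J              ≈⟨ ∙-congˡ (conj-unique x-inverts-h^J x-comm) ⟩
      h ^ J ∙ h ^ (-1ℤ ℤ.* J)    ≈⟨ ^-+ h J (-1ℤ ℤ.* J) ⟨
      h ^ (J ℤ.+ -1ℤ ℤ.* J)      ≈⟨ ^-exp h (eq′ J) ⟩
      ε                          ∎
      where
      eq : ∀ M e → + 8 ℤ.* M ℤ.* (-1ℤ ℤ.+ + 2 ℤ.* e ℤ.+ (-1ℤ ℤ.+ + 2 ℤ.* e))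
        ≡ + 16 ℤ.* M ℤ.* (1ℤ ℤ.+ + 2 ℤ.* (-1ℤ ℤ.+ e))
      eq = solve-∀
      eq′ : ∀ J → J ℤ.+ -1ℤ ℤ.* J ≡ 0ℤ
      eq′ = solve-∀
      b-comm : Conj (h ^ (-1ℤ ℤ.* J)) b b
      b-comm = sym (conj-resp (sym (^-* h -1ℤ J)) (sym (^-* h -1ℤ J)) (conj-^ J b-comm-h⁻¹))
      x-comm : Conj x (h ^ (-1ℤ ℤ.* J)) (h ^ (-1ℤ ℤ.* J))
      x-comm = sym (conj-∙ b-comm b-comm)

-- Automorphisms acting on the flags of a polytope.

module PolytopeProperties {n : ℕ} (P : Polytope n) where
  open ≡ using (refl; sym; trans; cong; subst; subst₂; module ≡-Reasoning)
  open Polytope P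
  open Automorphism
  private module G = Group (automorphismGroup P)

  to-injective : ∀ (φ : Automorphism P) {F G} → to φ F ≡ to φ G → F ≡ G
  to-injective φ {F} {G} p = begin
    F                 ≡⟨ strictlyInverseʳ φ F ⟨
    from φ (to φ F)   ≡⟨ cong (from φ) p ⟩
    from φ (to φ G)   ≡⟨ strictlyInverseʳ φ G ⟩
    G                 ∎
    where open ≡-Reasoning

  to-< : ∀ (φ : Automorphism P) {F G} → F < G → to φ F < to φ G
  to-< φ {F} {G} (le , ne) = Equivalence.to (order φ F G) le , λ p → ne (to-injective φ p)

  face-injective : ∀ Φ {k l} → face Φ k ≡ face Φ l → k ≡ l
  face-injective Φ {k} {l} p = trans (sym (face-rank Φ k)) (trans (cong rank p) (face-rank Φ l))

  face-< : ∀ Φ {k l} → k Fin.< l → face Φ k < face Φ l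
  face-< Φ lt = face-mono Φ (ℕ.<⇒≤ lt) , λ p → Fin.<⇒≢ lt (face-injective Φ p)

  ∈ᶠ⇒face-rank : ∀ Φ {F} → F ∈ᶠ Φ → face Φ (rank F) ≡ F
  ∈ᶠ⇒face-rank Φ (k , refl) = cong (face Φ) (face-rank Φ k)

  face-in-flag : ∀ F → ∃ λ Φ → face Φ (rank F) ≡ F
  face-in-flag F with extend (F ∷ []) ([] ∷ [])
  ... | Φ , F∈Φ ∷ [] = Φ , ∈ᶠ⇒face-rank Φ F∈Φ

  -- Along a flag through `F` the images strictly increase, so their ranks grow at least as fast as
  -- the index. The inverse automorphism supplies the other inequality in `rank-to`.
  rank≤rank-to : ∀ (φ : Automorphism P) F → rank F Fin.≤ rank (to φ F)
  rank≤rank-to φ F with face-in-flag F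
  ... | Φ , p = subst (λ H → rank F Fin.≤ rank (to φ H)) p (go (rank F))
    where
    go : ∀ k → k Fin.≤ rank (to φ (face Φ k))
    go = <-weakInduction (λ k → k Fin.≤ rank (to φ (face Φ k))) z≤n λ k ih →
      ℕ.≤-<-trans (subst (ℕ._≤ toℕ (rank (to φ (face Φ (inject₁ k))))) (Fin.toℕ-inject₁ k) ih)
        (rank-mono (to-< φ (face-< Φ (s≤s (ℕ.≤-reflexive (Fin.toℕ-inject₁ k))))))

  rank-to : ∀ (φ : Automorphism P) F → rank (to φ F) ≡ rank F
  rank-to φ F = Fin.≤-antisym
    (subst (λ H → rank (to φ F) Fin.≤ rank H) (strictlyInverseʳ φ F)
      (rank≤rank-to (φ G.⁻¹) (to φ F)))
    (rank≤rank-to φ F)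

  image : Automorphism P → Flag → Flag
  image φ Φ = record
    { face      = λ k → to φ (face Φ k)
    ; face-rank = λ k → trans (rank-to φ (face Φ k)) (face-rank Φ k)
    ; face-mono = λ le → Equivalence.to (order φ (face Φ _) (face Φ _)) (face-mono Φ le)
    }

  below above : Fin n → Fin (2 ℕ.+ n)
  below j = inject₁ (inject₁ j)
  above j = suc (suc j)

  toℕ-below : ∀ j → toℕ (below j) ≡ toℕ j
  toℕ-below j = trans (Fin.toℕ-inject₁ (inject₁ j)) (Fin.toℕ-inject₁ j)

  toℕ-properRank : ∀ j → toℕ (properRank j) ≡ suc (toℕ j)
  toℕ-properRank j = cong suc (Fin.toℕ-inject₁ j)

  below<properRank : ∀ j → below j Fin.< properRank j
  below<properRank j = subst₂ ℕ._<_ (sym (toℕ-below j)) (sym (toℕ-properRank j)) ℕ.≤-refl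

  properRank<above : ∀ j → properRank j Fin.< above j
  properRank<above j = subst (ℕ._< 2 ℕ.+ toℕ j) (sym (toℕ-properRank j)) ℕ.≤-refl

  below≢properRank : ∀ j → below j ≢ properRank j
  below≢properRank j = Fin.<⇒≢ (below<properRank j)

  above≢properRank : ∀ j → above j ≢ properRank j
  above≢properRank j p = Fin.<⇒≢ (properRank<above j) (sym p)

  -- Exactly what the diamond condition needs at rank `j`; unlike `Adjacent` it lets the flags
  -- differ at distant ranks, as they do in `turn²`.
  record AgreeAround (j : Fin n) (Φ Ψ : Flag) : Set where
    constructor agree
    field
      agree-below : face Φ (below j) ≡ face Ψ (below j)
      agree-above : face Φ (above j) ≡ face Ψ (above j)

  diamond-faces : ∀ j Φ → ∃₂ λ H K → H ≢ K ×
    (∀ Ψ → AgreeAround j Φ Ψ → face Ψ (properRank j) ≡ H ⊎ face Ψ (properRank j) ≡ K)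
  diamond-faces j Φ
    with diamond (face Φ (below j)) (face Φ (above j))
           (face-< Φ (Fin.<-trans (below<properRank j) (properRank<above j)))
           (subst₂ (λ p q → toℕ q ≡ 2 ℕ.+ toℕ p) (sym (face-rank Φ (below j))) (sym (face-rank Φ (above j)))
             (cong (2 ℕ.+_) (sym (toℕ-below j))))
  ... | H , K , H≢K , _ , _ , only = H , K , H≢K , λ Ψ (agree p q) →
    only (face Ψ (properRank j))
      (subst (_< face Ψ (properRank j)) (sym p) (face-< Ψ (below<properRank j)))
      (subst (face Ψ (properRank j) <_) (sym q) (face-< Ψ (properRank<above j)))

  -- The diamond leaves two distinct candidates, and it says which of them each flag uses.
  face≟ : ∀ j Φ Ψ → AgreeAround j Φ Ψ → Dec (face Φ (properRank j) ≡ face Ψ (properRank j))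
  face≟ j Φ Ψ a with diamond-faces j Φ
  ... | H , K , H≢K , only with only Φ (agree refl refl) | only Ψ a
  ...   | inj₁ p | inj₁ q = yes (trans p (sym q))
  ...   | inj₁ p | inj₂ q = no λ r → H≢K (trans (sym p) (trans r q))
  ...   | inj₂ p | inj₁ q = no λ r → H≢K (trans (sym q) (trans (sym r) p))
  ...   | inj₂ p | inj₂ q = yes (trans p (sym q))

  -- Only two faces fit at rank `j`, so changing twice returns to the start.
  flip-twice : ∀ j Φ Ψ Θ → AgreeAround j Φ Ψ → AgreeAround j Φ Θ →
    face Φ (properRank j) ≢ face Ψ (properRank j) →
    face Ψ (properRank j) ≢ face Θ (properRank j) →
    face Φ (properRank j) ≡ face Θ (properRank j)
  flip-twice j Φ Ψ Θ a a′ ne ne′ with diamond-faces j Φ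
  ... | H , K , H≢K , only with only Φ (agree refl refl) | only Ψ a | only Θ a′
  ...   | inj₁ p | _      | inj₁ r = trans p (sym r)
  ...   | inj₂ p | _      | inj₂ r = trans p (sym r)
  ...   | inj₁ p | inj₁ q | inj₂ r = contradiction (trans p (sym q)) ne
  ...   | inj₁ p | inj₂ q | inj₂ r = contradiction (trans q (sym r)) ne′
  ...   | inj₂ p | inj₁ q | inj₁ r = contradiction (trans q (sym r)) ne′
  ...   | inj₂ p | inj₂ q | inj₁ r = contradiction (trans p (sym q)) ne

  adjacent-sym : ∀ j Φ Ψ → Adjacent j Φ Ψ → Adjacent j Ψ Φ
  adjacent-sym j Φ Ψ (ne , same) = (λ p → ne (sym p)) , λ k p → sym (same k p)

  adjacent-resp : ∀ j Φ Φ′ Ψ Ψ′ → Φ ≈ᶠ Φ′ → Ψ ≈ᶠ Ψ′ → Adjacent j Φ Ψ → Adjacent j Φ′ Ψ′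
  adjacent-resp j Φ Φ′ Ψ Ψ′ p q (ne , same) =
    (λ r → ne (trans (p _) (trans r (sym (q _))))) ,
    λ k k≢ → trans (sym (p k)) (trans (same k k≢) (q k))

  adjacent-unique : ∀ j Φ Ψ Θ → Adjacent j Φ Ψ → Adjacent j Φ Θ → Ψ ≈ᶠ Θ
  adjacent-unique j Φ Ψ Θ (ne , same) (ne′ , same′) k with k Fin.≟ properRank j
  ... | no k≢    = trans (sym (same k k≢)) (same′ k k≢)
  ... | yes refl = flip-twice j Ψ Φ Θ
    (agree (sym (same (below j) b)) (sym (same (above j) a)))
    (agree (trans (sym (same (below j) b)) (same′ (below j) b))
           (trans (sym (same (above j) a)) (same′ (above j) a)))
    (λ p → ne (sym p)) ne′
    where
    b = below≢properRank j
    a = above≢properRank j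

  adjacent-image : ∀ φ j Φ Ψ → Adjacent j Φ Ψ → Adjacent j (image φ Φ) (image φ Ψ)
  adjacent-image φ j Φ Ψ (ne , same) = (λ p → ne (to-injective φ p)) , λ k k≢ → cong (to φ) (same k k≢)

  -- Uniqueness of adjacent flags propagates fixedness along paths of flags, and every face lies on
  -- a flag reached from `Φ`.
  fixes-flag⇒≈ε : ∀ φ Φ → image φ Φ ≈ᶠ Φ → φ G.≈ G.ε
  fixes-flag⇒≈ε φ Φ fix F with face-in-flag F
  ... | Ψ , F∈Ψ with connected Φ Ψ
  ...   | Ψ′ , path , Ψ′≈Ψ = begin
    to φ F                  ≡⟨ cong (to φ) F≡ ⟨
    to φ (face Ψ′ (rank F)) ≡⟨ walk path fix (rank F) ⟩
    face Ψ′ (rank F)        ≡⟨ F≡ ⟩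
    F                       ∎
    where
    open ≡-Reasoning
    F≡ : face Ψ′ (rank F) ≡ F
    F≡ = trans (Ψ′≈Ψ (rank F)) F∈Ψ
    walk : ∀ {Θ Θ′} → Star (StepOver Φ Ψ) Θ Θ′ → image φ Θ ≈ᶠ Θ → image φ Θ′ ≈ᶠ Θ′
    walk ε* p = p
    walk (_◅_ {i = Θ} {j = Θ₁} ((j , adj) , _) rest) p = walk rest
      (adjacent-unique j Θ (image φ Θ₁) Θ₁
        (adjacent-resp j (image φ Θ) Θ (image φ Θ₁) (image φ Θ₁) p (λ _ → refl)
          (adjacent-image φ j Θ Θ₁ adj))
        adj)

  -- Turn Φ k j σ says Φσ = (Φ^k)^j.
  Turn : Flag → Fin n → Fin n → Automorphism P → Set
  Turn Φ k j σ = ∃ λ Θ → Adjacent k Φ Θ × Adjacent j Θ (image σ Φ)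

  -- Automorphisms commute with taking adjacent flags: Φστ = ((Φ^j)^i)τ = ((Φτ)^j)^i, and Φτ =
  -- (Φ^k)^j, so the two flips at `j` cancel.
  turn-∙ : ∀ Φ k j i σ τ → Turn Φ j i σ → Turn Φ k j τ → Turn Φ k i (σ G.∙ τ)
  turn-∙ Φ k j i σ τ (Θ , Φ-Θ , Θ-Φσ) (Θ′ , Φ-Θ′ , Θ′-Φτ) =
    Θ′ , Φ-Θ′ , adjacent-resp i (image τ Θ) Θ′ (image τ (image σ Φ)) (image (σ G.∙ τ) Φ)
      (adjacent-unique j (image τ Φ) (image τ Θ) Θ′
        (adjacent-image τ j Φ Θ Φ-Θ) (adjacent-sym j Θ′ (image τ Φ) Θ′-Φτ))
      (λ _ → refl)
      (adjacent-image τ i Θ (image σ Φ) Θ-Φσ)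

  -- Flips at ranks at least two apart leave each other's diamonds alone, so `σ ∙ σ` flips each of
  -- the two ranks twice.
  turn² : ∀ Φ k j σ → suc (toℕ j) ℕ.< toℕ k → Turn Φ k j σ → σ G.∙ σ G.≈ G.ε
  turn² Φ k j σ 1+j<k (Θ , (Φ≢Θ , Φ-Θ) , (Θ≢Φσ , Θ-Φσ)) = fixes-flag⇒≈ε (σ G.∙ σ) Φ fixed
    where
    Φσ Θσ Φσσ : Flag
    Φσ  = image σ Φ
    Θσ  = image σ Θ
    Φσσ = image (σ G.∙ σ) Φ

    j<k : properRank j Fin.< properRank k
    j<k = subst₂ ℕ._<_ (sym (toℕ-properRank j)) (sym (toℕ-properRank k)) (ℕ.m≤n⇒m≤1+n 1+j<k)

    j≢k : properRank j ≢ properRank k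
    j≢k = Fin.<⇒≢ j<k

    k≢j : properRank k ≢ properRank j
    k≢j p = j≢k (sym p)

    off : ∀ p → p ≢ properRank k → p ≢ properRank j → to σ (face Φ p) ≡ face Φ p
    off p p≢k p≢j = sym (trans (Φ-Θ p p≢k) (Θ-Φσ p p≢j))

    belowk≢j : below k ≢ properRank j
    belowk≢j p = Fin.<⇒≢
      (subst₂ ℕ._<_ (sym (toℕ-properRank j)) (sym (toℕ-below k)) 1+j<k) (sym p)

    abovek≢j : above k ≢ properRank j
    abovek≢j p = Fin.<⇒≢ (Fin.<-trans j<k (properRank<above k)) (sym p)

    belowj≢k : below j ≢ properRank k
    belowj≢k = Fin.<⇒≢ (Fin.<-trans (below<properRank j) j<k)

    abovej≢k : above j ≢ properRank k
    abovej≢k = Fin.<⇒≢ (subst (2 ℕ.+ toℕ j ℕ.<_) (sym (toℕ-properRank k)) (s≤s 1+j<k))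

    fixed : Φσσ ≈ᶠ Φ
    fixed p with p Fin.≟ properRank k
    -- `Φσ` and `Θ` share their `k`-face, so `Θσ` stands in for `Φσσ` at this rank.
    ... | yes refl = trans (sym (cong (to σ) (Θ-Φσ p k≢j)))
      (sym (flip-twice k Φ Θ Θσ
        (agree (Φ-Θ (below k) (below≢properRank k)) (Φ-Θ (above k) (above≢properRank k)))
        (agree (at (below k) (below≢properRank k) belowk≢j) (at (above k) (above≢properRank k) abovek≢j))
        Φ≢Θ
        (λ q → Φ≢Θ (to-injective σ (trans (sym (Θ-Φσ p k≢j)) q)))))
      where
      at : ∀ p → p ≢ properRank k → p ≢ properRank j → face Φ p ≡ face Θσ p
      at p p≢k p≢j = trans (sym (off p p≢k p≢j)) (cong (to σ) (Φ-Θ p p≢k))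
    ... | no p≢k with p Fin.≟ properRank j
    ...   | yes refl = sym (flip-twice j Φ Φσ Φσσ
      (agree (sym (off (below j) belowj≢k (below≢properRank j)))
             (sym (off (above j) abovej≢k (above≢properRank j))))
      (agree (sym (off² (below j) belowj≢k (below≢properRank j)))
             (sym (off² (above j) abovej≢k (above≢properRank j))))
      (λ q → Θ≢Φσ (trans (sym (Φ-Θ p j≢k)) q))
      (λ q → Θ≢Φσ (trans (sym (Φ-Θ p j≢k)) (to-injective σ q))))
      where
      off² : ∀ p → p ≢ properRank k → p ≢ properRank j → face Φσσ p ≡ face Φ p
      off² p p≢k p≢j = trans (cong (to σ) (off p p≢k p≢j)) (off p p≢k p≢j)
    ...   | no p≢j = trans (cong (to σ) (off p p≢k p≢j)) (off p p≢k p≢j)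

allPairs-universal : ∀ {A : Set} {R : A → A → Set} → (∀ x y → R x y) → ∀ xs → AllPairs R xs
allPairs-universal total []       = []
allPairs-universal total (x ∷ xs) = All.universal (total x) xs ∷ allPairs-universal total xs

-- The rotation of a polygonal section by a standard generator.

module Rotation {m : ℕ} (P : Polytope (suc m)) (Φ : Polytope.Flag P) (i : Fin m) (σ : Automorphism P)
  (σ-turn : PolytopeProperties.Turn P Φ (suc i) (inject₁ i) σ) where
  open ≡ using (refl; sym; trans; cong; subst; subst₂; module ≡-Reasoning)
  open Polytope P
  open Automorphism
  open PolytopeProperties P
  open IsPartialOrder isPartialOrder using () renaming (trans to ≤-trans)
  private module G = Group (automorphismGroup P)
  open GroupPowers (automorphismGroup P)

  T : Flag
  T = proj₁ σ-turn

  Φ-T : Adjacent (suc i) Φ T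
  Φ-T = proj₁ (proj₂ σ-turn)

  T-Φσ : Adjacent (inject₁ i) T (image σ Φ)
  T-Φσ = proj₂ (proj₂ σ-turn)

  -- With ranks shifted by one: the (i-1)-face, the vertices, the edges and the (i+2)-face of the
  -- polygonal section.
  lo vertexRank edgeRank hi : Fin (3 ℕ.+ m)
  lo         = below (inject₁ i)
  vertexRank = properRank (inject₁ i)
  edgeRank   = properRank (suc i)
  hi         = above (suc i)

  Off : Fin (3 ℕ.+ m) → Set
  Off k = k ≢ vertexRank × k ≢ edgeRank

  off? : ∀ k → Dec (Off k)
  off? k = ¬? (k Fin.≟ vertexRank) ×-dec ¬? (k Fin.≟ edgeRank)

  Fixed : Automorphism P → Set
  Fixed φ = ∀ k → Off k → to φ (face Φ k) ≡ face Φ k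

  lo-off : Off lo
  lo-off = below≢properRank (inject₁ i) ,
    Fin.<⇒≢ (Fin.<-trans (below<properRank (inject₁ i)) (properRank<above (inject₁ i)))

  hi-off : Off hi
  hi-off = (λ p → Fin.<⇒≢ (Fin.<-trans (properRank<above (inject₁ i)) (properRank<above (suc i))) (sym p)) ,
    above≢properRank (suc i)

  power-fixed : ∀ s → Fixed (σ ^ s)
  power-fixed s k off = go s
    where
    σ-fixed : to σ (face Φ k) ≡ face Φ k
    σ-fixed = sym (trans (proj₂ Φ-T k (proj₂ off)) (proj₂ T-Φσ k (proj₁ off)))
    go⁺ : ∀ n → to (σ ^ + n) (face Φ k) ≡ face Φ k
    go⁺ zero    = refl
    go⁺ (suc n) = trans (cong (to (σ ^ + n)) σ-fixed) (go⁺ n)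
    go : ∀ s → to (σ ^ s) (face Φ k) ≡ face Φ k
    go (+ n)      = go⁺ n
    go ℤ.-[1+ n ] = trans (cong (from (σ ^ + suc n)) (sym (go⁺ (suc n))))
                      (strictlyInverseʳ (σ ^ + suc n) (face Φ k))

  vertex : ℤ → Face
  vertex s = to (σ ^ s) (face Φ vertexRank)

  -- The flags containing the faces of Φ of ranks other than those of the
  -- vertices and edges of the section are the Φσˢ and the (Φσˢ)^(i+1).
  data Reached (Θ : Flag) : Set where
    power : ∀ s → image (σ ^ s) Φ ≈ᶠ Θ → Reached Θ
    after : ∀ s → Adjacent (suc i) (image (σ ^ s) Φ) Θ → Reached Θ

  reached-vertex : ∀ Θ → Reached Θ → ∃ λ s → face Θ vertexRank ≡ vertex s
  reached-vertex Θ (power s p)          = s , sym (p vertexRank)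
  reached-vertex Θ (after s (_ , same)) = s , sym (same vertexRank (Fin.<⇒≢ (properRank<above (inject₁ i))))

  reached-off : ∀ Θ → Reached Θ → ∀ k → Off k → face Θ k ≡ face Φ k
  reached-off Θ (power s p)          k off = trans (sym (p k)) (power-fixed s k off)
  reached-off Θ (after s (_ , same)) k off = trans (sym (same k (proj₂ off))) (power-fixed s k off)

  reached-edge-step : ∀ Θ Θ′ → Reached Θ → Adjacent (suc i) Θ Θ′ → Reached Θ′
  reached-edge-step Θ Θ′ (power s p) adj = after s
    (adjacent-resp (suc i) Θ (image (σ ^ s) Φ) Θ′ Θ′ (λ k → sym (p k)) (λ _ → refl) adj)
  reached-edge-step Θ Θ′ (after s adj′) adj = power s
    (adjacent-unique (suc i) Θ (image (σ ^ s) Φ) Θ′ (adjacent-sym (suc i) (image (σ ^ s) Φ) Θ adj′) adj)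

  -- With T = Φ^(i+1) and Φσ = T^i one has (Φσ^s)^i = Tσ^(s-1) and (Tσ^s)^i = Φσ^(s+1), hence the
  -- shifts of the exponent.
  reached-vertex-step : ∀ Θ Θ′ → Reached Θ → Adjacent (inject₁ i) Θ Θ′ → Reached Θ′
  reached-vertex-step Θ Θ′ (power s p) adj = after (ℤ.pred s)
    (adjacent-resp (suc i) Φτ Φτ Tτ Θ′ (λ _ → refl)
      (adjacent-unique (inject₁ i) Θ Tτ Θ′
        (adjacent-resp (inject₁ i) (image τ (image σ Φ)) Θ Tτ Tτ
          (λ k → trans (sym (^-suc σ (ℤ.pred s) (face Φ k)))
                   (trans (^-exp σ (ℤ.suc-pred s) (face Φ k)) (p k)))
          (λ _ → refl)
          (adjacent-sym (inject₁ i) Tτ (image τ (image σ Φ))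
            (adjacent-image τ (inject₁ i) T (image σ Φ) T-Φσ)))
        adj)
      (adjacent-image τ (suc i) Φ T Φ-T))
    where
    τ = σ ^ ℤ.pred s
    Φτ = image τ Φ
    Tτ = image τ T
  reached-vertex-step Θ Θ′ (after s adj′) adj = power (ℤ.suc s)
    λ k → trans (^-suc σ s (face Φ k))
      (adjacent-unique (inject₁ i) Θ (image τ (image σ Φ)) Θ′
        (adjacent-resp (inject₁ i) Tτ Θ (image τ (image σ Φ)) (image τ (image σ Φ))
          (adjacent-unique (suc i) (image τ Φ) Tτ Θ (adjacent-image τ (suc i) Φ T Φ-T) adj′)
          (λ _ → refl)
          (adjacent-image τ (inject₁ i) T (image σ Φ) T-Φσ))
        adj k)
    where
    τ = σ ^ s
    Tτ = image τ T

  properRank-injective : ∀ {j k} → properRank j ≡ properRank k → j ≡ k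
  properRank-injective p = Fin.inject₁-injective (Fin.suc-injective p)

  -- Both flags contain the faces of `Φ` at the `Off` ranks, so the flip can only happen at the
  -- vertex or the edge rank.
  reached-step : ∀ Θ Θ′ j → (∀ k → Off k → face Θ′ k ≡ face Φ k) →
    Reached Θ → Adjacent j Θ Θ′ → Reached Θ′
  reached-step Θ Θ′ j fixed r adj@(ne , _) with properRank j Fin.≟ vertexRank | properRank j Fin.≟ edgeRank
  ... | yes p | _     = reached-vertex-step Θ Θ′ r (subst (λ j → Adjacent j Θ Θ′) (properRank-injective p) adj)
  ... | no  _ | yes q = reached-edge-step Θ Θ′ r (subst (λ j → Adjacent j Θ Θ′) (properRank-injective q) adj)
  ... | no ¬p | no ¬q = contradiction
    (trans (reached-off Θ r (properRank j) (¬p , ¬q)) (sym (fixed (properRank j) (¬p , ¬q)))) ne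

  F G : Face
  F = face Φ lo
  G = face Φ hi

  toℕ-vertexRank : toℕ vertexRank ≡ suc (toℕ (rank F))
  toℕ-vertexRank = trans (toℕ-properRank (inject₁ i))
    (cong suc (sym (trans (cong toℕ (face-rank Φ lo)) (toℕ-below (inject₁ i)))))

  off-cases : ∀ k → Off k → k Fin.≤ lo ⊎ hi Fin.≤ k
  off-cases k (k≢v , k≢e) with k Fin.≤? lo
  ... | yes p = inj₁ p
  ... | no ¬p = inj₂ (ℕ.≤∧≢⇒< (ℕ.≤∧≢⇒< i<k k≢v′) k≢e′)
    where
    i<k : toℕ i ℕ.< toℕ k
    i<k = subst (ℕ._< toℕ k) (trans (toℕ-below (inject₁ i)) (Fin.toℕ-inject₁ i)) (ℕ.≰⇒> ¬p)
    k≢v′ : suc (toℕ i) ≢ toℕ k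
    k≢v′ p = k≢v (Fin.toℕ-injective (trans (sym p)
      (sym (trans (toℕ-properRank (inject₁ i)) (cong suc (Fin.toℕ-inject₁ i))))))
    k≢e′ : suc (suc (toℕ i)) ≢ toℕ k
    k≢e′ p = k≢e (Fin.toℕ-injective (trans (sym p) (sym (toℕ-properRank (suc i)))))

  -- `H` lies between `F` and `G`, hence is comparable with every face of `Φ` at an `Off` rank;
  -- `extend` completes the resulting chain.
  flag-through : ∀ H → F ≤ H → H ≤ G → rank H ≡ vertexRank →
    ∃ λ Ψ → face Ψ vertexRank ≡ H × (∀ k → Off k → face Ψ k ≡ face Φ k)
  flag-through H F≤H H≤G rankH with extend (H ∷ map (face Φ) ks) (All.map⁺ comparable ∷ chain)
    where
    ks = filter off? (allFin (3 ℕ.+ m))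
    comparable : All (λ k → H ≤ face Φ k ⊎ face Φ k ≤ H) ks
    comparable = All.map compare (All.all-filter off? (allFin (3 ℕ.+ m)))
      where
      compare : ∀ {k} → Off k → H ≤ face Φ k ⊎ face Φ k ≤ H
      compare {k} off with off-cases k off
      ... | inj₁ k≤lo = inj₂ (≤-trans (face-mono Φ k≤lo) F≤H)
      ... | inj₂ hi≤k = inj₁ (≤-trans H≤G (face-mono Φ hi≤k))
    chain : IsChain (map (face Φ) ks)
    chain = AllPairs.map⁺ (allPairs-universal total ks)
      where
      total : ∀ k l → face Φ k ≤ face Φ l ⊎ face Φ l ≤ face Φ k
      total k l with ℕ.≤-total (toℕ k) (toℕ l)
      ... | inj₁ k≤l = inj₁ (face-mono Φ k≤l)
      ... | inj₂ l≤k = inj₂ (face-mono Φ l≤k)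
  ... | Ψ , H∈Ψ ∷ rest = Ψ ,
    trans (cong (face Ψ) (sym rankH)) (∈ᶠ⇒face-rank Ψ H∈Ψ) ,
    λ k off → trans (cong (face Ψ) (sym (face-rank Φ k)))
      (∈ᶠ⇒face-rank Ψ (All.lookup (All.map⁻ rest) (∈-filter⁺ off? (∈-allFin k) off)))

  -- Strong connectedness joins `Φ` to a flag through `H` by a path that keeps their common faces,
  -- so it never leaves the section and all its flags are `Reached`.
  orbit-covers : ∀ H → F ≤ H → H ≤ G → rank H ≡ vertexRank → ∃ λ s → H ≡ vertex s
  orbit-covers H F≤H H≤G rankH with flag-through H F≤H H≤G rankH
  ... | Ψ , Ψ∋H , Ψ-off with connected Φ Ψ
  ...   | Ψ′ , path , Ψ′≈Ψ with reached-vertex Ψ′ (walk path (power 0ℤ λ _ → refl))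
    where
    walk : ∀ {Θ Θ′} → Star (StepOver Φ Ψ) Θ Θ′ → Reached Θ → Reached Θ′
    walk ε* r = r
    walk (_◅_ {i = Θ} {j = Θ₁} ((j , adj) , meet) rest) r = walk rest
      (reached-step Θ Θ₁ j
        (λ k off → trans (cong (face Θ₁) (sym (face-rank Φ k)))
          (∈ᶠ⇒face-rank Θ₁ (meet (face Φ k) (k , refl) (k , Ψ-off k off))))
        r adj)
  ...     | s , p = s , trans (sym Ψ∋H) (trans (sym (Ψ′≈Ψ vertexRank)) p)

  module Section {p : ℕ} (size : HasSize (sectionVertices P F G) p) where
    open Inverse size using ()
      renaming (to to nth; from to index; strictlyInverseˡ to nth-index; inverse to size-inverse)

    sectionVertex : ℤ → Setoid.Carrier (sectionVertices P F G)
    sectionVertex s = vertex s ,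
      subst (_≤ vertex s) (power-fixed s lo lo-off)
        (face-mono (image (σ ^ s) Φ) (ℕ.<⇒≤ (below<properRank (inject₁ i)))) ,
      subst (vertex s ≤_) (power-fixed s hi hi-off)
        (face-mono (image (σ ^ s) Φ)
          (ℕ.<⇒≤ (Fin.<-trans (properRank<above (inject₁ i)) (properRank<above (suc i))))) ,
      trans (cong toℕ (face-rank (image (σ ^ s) Φ) vertexRank)) toℕ-vertexRank

    vertex-section : ∀ (V : Setoid.Carrier (sectionVertices P F G)) → ∃ λ s → proj₁ V ≡ vertex s
    vertex-section (H , F≤H , H≤G , rankH) = orbit-covers H F≤H H≤G
      (Fin.toℕ-injective (trans rankH (sym toℕ-vertexRank)))

    vertex-shift : ∀ s t → vertex (s ℤ.+ t) ≡ to (σ ^ t) (vertex s)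
    vertex-shift s t = ^-+ σ s t (face Φ vertexRank)

    -- Each section vertex is `vertex s` for some `s`, and `s` counts only modulo `d`: the `p`
    -- vertices inject into the residues.
    minimal : ∀ d .{{_ : ℕ.NonZero d}} → σ ^ + d G.≈ G.ε → p ℕ.≤ d
    minimal d σ^d = Fin.injective⇒≤ {f = residue} residue-injective
      where
      exponent : Fin p → ℤ
      exponent t = proj₁ (vertex-section (nth t))
      residue : Fin p → Fin d
      residue t = Fin.fromℕ< (n%ℕd<d (exponent t) d)
      vertex-residue : ∀ t → proj₁ (nth t) ≡ vertex (+ toℕ (residue t))
      vertex-residue t = begin
        proj₁ (nth t)                ≡⟨ proj₂ (vertex-section (nth t)) ⟩
        vertex s                     ≡⟨ cong vertex (a≡a%ℕn+[a/ℕn]*n s d) ⟩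
        vertex (+ r ℤ.+ q)           ≡⟨ cong vertex (ℤ.+-comm (+ r) q) ⟩
        vertex (q ℤ.+ + r)           ≡⟨ vertex-shift q (+ r) ⟩
        to (σ ^ + r) (vertex q)      ≡⟨ cong (to (σ ^ + r)) (σ^q (face Φ vertexRank)) ⟩
        vertex (+ r)                 ≡⟨ cong (λ r → vertex (+ r)) (Fin.toℕ-fromℕ< (n%ℕd<d s d)) ⟨
        vertex (+ toℕ (residue t))   ∎
        where
        open ≡-Reasoning
        s = exponent t
        r = s %ℕ d
        q = s /ℕ d ℤ.* + d
        σ^q : σ ^ q G.≈ G.ε
        σ^q = ^-multiple σ (+ d) (s /ℕ d) σ^d (ℤ.*-comm (s /ℕ d) (+ d))
      residue-injective : ∀ {t u} → residue t ≡ residue u → t ≡ u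
      residue-injective {t} {u} eq = begin
        t              ≡⟨ proj₂ size-inverse refl ⟨
        index (nth t)  ≡⟨ proj₂ size-inverse (trans (vertex-residue t)
                            (trans (cong (λ r → vertex (+ toℕ r)) eq) (sym (vertex-residue u)))) ⟩
        u              ∎
        where open ≡-Reasoning

    module _ (chiral : IsChiral P) where
      -- Only the edge could still move; `Φ` and its image would then be adjacent flags in one
      -- orbit, which chirality forbids.
      fixes-vertex⇒≈ε : ∀ s → vertex s ≡ face Φ vertexRank → σ ^ s G.≈ G.ε
      fixes-vertex⇒≈ε s fix = fixes-flag⇒≈ε (σ ^ s) Φ fixed
        where
        same : ∀ k → k ≢ edgeRank → face Φ k ≡ to (σ ^ s) (face Φ k)
        same k k≢e with k Fin.≟ vertexRank
        ... | yes refl = sym fix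
        ... | no k≢v   = sym (power-fixed s k (k≢v , k≢e))
        fixed : image (σ ^ s) Φ ≈ᶠ Φ
        fixed k with k Fin.≟ edgeRank
        ... | no k≢e = sym (same k k≢e)
        ... | yes refl with face≟ (suc i) Φ (image (σ ^ s) Φ)
                (agree (same vertexRank (below≢properRank (suc i))) (same hi (above≢properRank (suc i))))
        ...   | yes eq = sym eq
        ...   | no ne  = ⊥-elim (IsChiral.adjacentOrbits chiral (suc i) Φ (image (σ ^ s) Φ) (ne , same)
                           (σ ^ s , λ _ → refl))

      -- Among the p + 1 exponents 0, ..., p two give the same vertex, so σ^d = `ε` for some 0 < d ≤
      -- p; `minimal` forces d = p.
      σ^p≈ε : σ ^ + p G.≈ G.ε
      σ^p≈ε with Fin.pigeonhole (ℕ.n<1+n p) (λ s → index (sectionVertex (+ toℕ s)))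
      ... | s , t , s<t , eq = subst (λ d → σ ^ + d G.≈ G.ε)
        (ℕ.≤-antisym d≤p (minimal d {{ℕ.>-nonZero (ℕ.m<n⇒0<n∸m s<t)}} σ^d)) σ^d
        where
        d = toℕ t ℕ.∸ toℕ s
        d≤p : d ℕ.≤ p
        d≤p = ℕ.≤-trans (ℕ.m∸n≤m (toℕ t) (toℕ s)) (ℕ.≤-pred (Fin.toℕ<n t))
        vertices-equal : vertex (+ toℕ s) ≡ vertex (+ toℕ t)
        vertices-equal = trans (sym (nth-index (sectionVertex (+ toℕ s)))) (proj₁ size-inverse eq)
        σ^d : σ ^ + d G.≈ G.ε
        σ^d = fixes-vertex⇒≈ε (+ d) (to-injective (σ ^ + toℕ s) (begin
          to (σ ^ + toℕ s) (vertex (+ d))   ≡⟨ vertex-shift (+ d) (+ toℕ s) ⟨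
          vertex (+ (d ℕ.+ toℕ s))          ≡⟨ cong (λ n → vertex (+ n)) (ℕ.m∸n+n≡m (ℕ.<⇒≤ s<t)) ⟩
          vertex (+ toℕ t)                  ≡⟨ vertices-equal ⟨
          vertex (+ toℕ s)                  ∎))
          where open ≡-Reasoning

-- From the relations of the theorem to the exponents of the collapse.

module _ {g ℓ : Level} (G : Group g ℓ) where
  open Group G
  open GroupPowers G

  -- With β = 5 + γ, `Collapse` is applied at M = 2^γ and e = ε₂M.
  relations⇒collapse : ∀ γ {ε₁ ε₂ a b c} →
    a ∙ b ∙ (a ∙ b) ≈ ε → b ∙ c ∙ (b ∙ c) ≈ ε → a ∙ b ∙ c ∙ (a ∙ b ∙ c) ≈ ε →
    b ^ + (2 ℕ.^ (4 ℕ.+ γ)) ≈ ε → c ^ + (2 ℕ.^ (5 ℕ.+ γ)) ≈ ε →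
    ε₁ ≡ 0ℤ ⊎ ε₁ ≡ 1ℤ → ε₂ ≡ 1ℤ ⊎ ε₂ ≡ -1ℤ →
    Relations G (5 ℕ.+ γ) ε₁ ε₂ a b c →
    c ^ + (2 ℕ.^ (4 ℕ.+ γ)) ≈ ε
  relations⇒collapse γ {ε₁} {ε₂} {a} {b} {c} ab² bc² abc² b^ c^ ε₁-values ε₂-values relations =
    trans (^-exp c (2^≡ 4)) v≈ε
    where
    open Relations relations

    M : ℤ
    M = + (2 ℕ.^ γ)

    2^≡ : ∀ k → + (2 ℕ.^ (k ℕ.+ γ)) ≡ + (2 ℕ.^ k) ℤ.* M
    2^≡ k = ≡.trans (≡.cong +_ (ℕ.^-distribˡ-+-* 2 k γ)) (ℤ.pos-* (2 ℕ.^ k) (2 ℕ.^ γ))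

    ε₂N≡ : ε₂ ℤ.* + (2 ℕ.^ (3 ℕ.+ γ)) ≡ + 8 ℤ.* (ε₂ ℤ.* M)
    ε₂N≡ = ≡.trans (≡.cong (ε₂ ℤ.*_) (2^≡ 3)) (swap ε₂ M)
      where
      swap : ∀ ε M → ε ℤ.* (+ 8 ℤ.* M) ≡ + 8 ℤ.* (ε ℤ.* M)
      swap = solve-∀

    c^32M : c ^ (+ 32 ℤ.* M) ≈ ε
    c^32M = trans (^-exp c (≡.sym (2^≡ 5))) c^

    -- For ε₂ = -1 the exponents -16M and 16M differ by 32M, a period of `c`.
    c^16ε₂M : ∀ {ε₂} → ε₂ ≡ 1ℤ ⊎ ε₂ ≡ -1ℤ → c ^ (+ 16 ℤ.* (ε₂ ℤ.* M)) ≈ c ^ (+ 16 ℤ.* M)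
    c^16ε₂M (inj₁ ≡.refl) = ^-exp c (≡.cong (+ 16 ℤ.*_) (ℤ.*-identityˡ M))
    c^16ε₂M (inj₂ ≡.refl) = trans (^-exp c (eq M))
      (trans (^-+ c (+ 16 ℤ.* M) (+ 32 ℤ.* M ℤ.* -1ℤ))
        (trans (∙-congˡ (^-multiple c (+ 32 ℤ.* M) -1ℤ c^32M ≡.refl)) (identityʳ _)))
      where
      eq : ∀ M → + 16 ℤ.* (-1ℤ ℤ.* M) ≡ + 16 ℤ.* M ℤ.+ + 32 ℤ.* M ℤ.* -1ℤ
      eq = solve-∀

    open Collapse G a b c ab² bc² abc² M (ε₂ ℤ.* M) ε₁
      (trans (^-exp b (≡.sym (2^≡ 4))) b^)
      c^32M
      (c^16ε₂M ε₂-values)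
      ε₁-values
      (trans relation₁ (∙-congˡ (^-exp b (≡.cong (λ N → + 3 ℤ.- ε₁ ℤ.* N) (2^≡ 3)))))
      (trans relation₂ (∙-cong
        (^-exp b (≡.cong (λ N → ℤ.- + 1 ℤ.+ N) (2^≡ 3)))
        (^-exp c (≡.cong (λ n → ℤ.- + 3 ℤ.+ n) ε₂N≡))))
      (trans relation₃ (∙-cong
        (^-exp b (≡.cong (λ N → + 1 ℤ.+ N) (2^≡ 3)))
        (^-exp c (≡.cong (λ n → + 3 ℤ.+ n) ε₂N≡))))
      using (v≈ε)

-- Standard generators as turns, and their orders.

module _ {m : ℕ} (P : Polytope (suc m)) (Φ : Polytope.Flag P) where
  open ≡ using (refl; sym; trans; cong)
  open Polytope P
  open PolytopeProperties P
  open GroupPowers (automorphismGroup P)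
  private module G = Group (automorphismGroup P)

  standardGenerator⇒turn : ∀ i σ → IsStandardGenerator P Φ i σ → Turn Φ (suc i) (inject₁ i) σ
  standardGenerator⇒turn i σ (Θ , Ψ , Φ-Θ , Θ-Ψ , maps) =
    Θ , Φ-Θ , adjacent-resp (inject₁ i) Θ Θ Ψ (image σ Φ) (λ _ → refl) (λ k → sym (maps k)) Θ-Ψ

  module StandardGeneratorOrder (ps : Vec ℕ m) (type : HasType P ps) (i : Fin m) (σ : Automorphism P)
    (σ-generator : IsStandardGenerator P Φ i σ) where
    open Rotation P Φ i σ (standardGenerator⇒turn i σ σ-generator)

    open Section
      (type i F G
        (face-mono Φ (ℕ.≤-trans (ℕ.<⇒≤ (below<properRank (inject₁ i)))
          (ℕ.<⇒≤ (Fin.<-trans (properRank<above (inject₁ i)) (properRank<above (suc i))))))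
        (trans (cong toℕ (face-rank Φ lo)) (trans (toℕ-below (inject₁ i)) (Fin.toℕ-inject₁ i)))
        (cong toℕ (face-rank Φ hi)))
      public using (minimal; σ^p≈ε)

open import Data.Nat.Base using (_≤_; _∸_; _^_)

theorem5p13 : (β : ℕ) (ε₁ ε₂ : ℤ) → 5 ≤ β → ε₁ ≡ 0ℤ ⊎ ε₁ ≡ 1ℤ → ε₂ ≡ 1ℤ ⊎ ε₂ ≡ -1ℤ →
    ¬ (Σ[ P ∈ Polytope 4 ]
    IsChiral P ×
    IsTightOfType P (2 ^ (β ∸ 2) ∷ 2 ^ (β ∸ 1) ∷ 2 ^ β ∷ []) ×
    Σ[ Φ ∈ Polytope.Flag P ] Σ[ σ₁ ∈ Automorphism P ] Σ[ σ₂ ∈ Automorphism P ] Σ[ σ₃ ∈ Automorphism P ]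
    IsStandardGenerator P Φ zero σ₁ ×
    IsStandardGenerator P Φ (suc zero) σ₂ ×
    IsStandardGenerator P Φ (suc (suc zero)) σ₃ ×
    Relations (automorphismGroup P) β ε₁ ε₂ σ₁ σ₂ σ₃)
theorem5p13 _ ε₁ ε₂ (s≤s (s≤s (s≤s (s≤s (s≤s (z≤n {γ})))))) ε₁-values ε₂-values
  (P , chiral , (type , _) , Φ , a , b , c , a-generator , b-generator , c-generator , relations) =
  -- `C.minimal` would bound the section size 2^(5+γ) by the exponent 2^(4+γ).
  ℕ.<⇒≱ (ℕ.^-monoʳ-< 2 (s≤s (s≤s z≤n)) (ℕ.n<1+n (4 ℕ.+ γ)))
    (C.minimal (2 ^ (4 ℕ.+ γ)) {{ℕ.m^n≢0 2 (4 ℕ.+ γ)}}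
      (relations⇒collapse (automorphismGroup P) γ
        -- The products turn `Φ` at the rank pairs (2,0), (3,1) and (3,0), each at least two apart.
        (turn² Φ 2F 0F (a ∙ b) (s≤s (s≤s z≤n)) ab-turn)
        (turn² Φ 3F 1F (b ∙ c) (s≤s (s≤s (s≤s z≤n))) bc-turn)
        (turn² Φ 3F 0F (a ∙ b ∙ c) (s≤s (s≤s z≤n)) abc-turn)
        (B.σ^p≈ε chiral) (C.σ^p≈ε chiral) ε₁-values ε₂-values relations))
  where
  open Group (automorphismGroup P) using (_∙_)
  open PolytopeProperties P using (turn-∙; turn²)

  ps : Vec ℕ 3
  ps = 2 ^ (3 ℕ.+ γ) ∷ 2 ^ (4 ℕ.+ γ) ∷ 2 ^ (5 ℕ.+ γ) ∷ []

  module B = StandardGeneratorOrder P Φ ps type 1F b b-generator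
  module C = StandardGeneratorOrder P Φ ps type 2F c c-generator

  a-turn   = standardGenerator⇒turn P Φ 0F a a-generator
  b-turn   = standardGenerator⇒turn P Φ 1F b b-generator
  c-turn   = standardGenerator⇒turn P Φ 2F c c-generator
  ab-turn  = turn-∙ Φ 2F 1F 0F a b a-turn b-turn
  bc-turn  = turn-∙ Φ 3F 2F 1F b c b-turn c-turn
  abc-turn = turn-∙ Φ 3F 2F 0F (a ∙ b) c ab-turn c-turn
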